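{- The class of $X$-free ordered graphs is $\chi$-bounded: there is a function $f:\mathbb{N}\to\mathbb{N}$ such that every $X$-free ordered graph $(G,\prec)$ with clique number $\omega$ satisfies $\chi(G)\le f(\omega)$.
   Context: An ordered graph is a pair $(G,\prec)$ where $G$ is a finite graph and $\prec$ is a linear order on $V(G)$. $X$ denotes the ordered graph on vertices $a\prec b\prec c\prec d$ with edge set exactly $\{ac,bd\}$. An ordered graph is $X$-free if it has no four vertices $a\prec b\prec c\prec d$ whose induced ordered subgraph is $X$, i.e. with $ac,bd\in E(G)$ and $ab,bc,cd,ad\notin E(G)$. -}

module Defs where

open import Data.Fin using (Fin; finToFun; funToFin)
open import Data.Fin.Properties using (any?; all?; injective⇒≤; finToFun-funToFin) renaming (_≟_ to _≟ᶠ_)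
open import Data.Nat using (ℕ; zero; suc; _^_; _≤_; z≤n; s≤s)
open import Data.Nat.Properties using (m≤n⇒m<n∨m≡n)
open import Data.Product using (∃; _×_; _,_; proj₁; proj₂)
open import Data.Sum using (inj₁; inj₂)
open import Function using (_∘_)
open import Function.Bundles using (_↔_; Inverse)
open import Relation.Binary.Core using (Rel)
open import Relation.Binary.Definitions using (Symmetric; Irreflexive; Decidable)
open import Relation.Binary.PropositionalEquality using (_≡_; _≢_; refl; sym; trans; cong; subst₂)
open import Relation.Binary.Structures using (IsStrictTotalOrder)
open import Relation.Nullary using (¬_; yes; no; contradiction)
open import Relation.Nullary.Decidable using (map′; ¬?; _→-dec_)
open import Relation.Unary using (Pred) renaming (Decidable to Decidable₁)
open import Level using (0ℓ)

record FiniteGraph : Set₁ where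
  field
    V       : Set
    order   : ℕ
    finite  : V ↔ Fin order
    Adj     : Rel V 0ℓ
    adj?    : Decidable Adj
    symm    : Symmetric Adj
    irrefl  : Irreflexive _≡_ Adj

record OrderedGraph : Set₁ where
  field
    graph              : FiniteGraph
  open FiniteGraph graph public
  field
    _≺_                : Rel V 0ℓ
    isStrictTotalOrder : IsStrictTotalOrder _≡_ _≺_

module _ (G : OrderedGraph) where
  open OrderedGraph G

  record InducedX (a b c d : V) : Set where
    field
      a≺b : a ≺ b
      b≺c : b ≺ c
      c≺d : c ≺ d
      ac  : Adj a c
      bd  : Adj b d
      ¬ab : ¬ Adj a b
      ¬bc : ¬ Adj b c
      ¬cd : ¬ Adj c d
      ¬ad : ¬ Adj a d

  XFree : Set
  XFree = ∀ a b c d → ¬ InducedX a b c d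

IsLeast : Pred ℕ 0ℓ → ℕ → Set
IsLeast P k = P k × (∀ m → P m → k ≤ m)

IsGreatest : Pred ℕ 0ℓ → ℕ → Set
IsGreatest P k = P k × (∀ m → P m → m ≤ k)

module _ (G : FiniteGraph) where
  open FiniteGraph G

  IsProperColouring : ∀ {k} → (V → Fin k) → Set
  IsProperColouring c = ∀ u v → Adj u v → c u ≢ c v

  Colourable : Pred ℕ 0ℓ
  Colourable k = ∃ λ (c : V → Fin k) → IsProperColouring c

  -- The k listed vertices are automatically distinct, as Adj is irreflexive.
  IsClique : ∀ {k} → (Fin k → V) → Set
  IsClique q = ∀ i j → i ≢ j → Adj (q i) (q j)

  HasClique : Pred ℕ 0ℓ
  HasClique k = ∃ λ (q : Fin k → V) → IsClique q

least : ∀ {P : Pred ℕ 0ℓ} → Decidable₁ P → ∀ n → P n → ∃ (IsLeast P)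
least {P} P? n pn with P? 0
... | yes p0 = 0 , p0 , λ _ _ → z≤n
least {P} P? zero    pn | no ¬p0 = contradiction pn ¬p0
least {P} P? (suc n) pn | no ¬p0 with least (P? ∘ suc) n pn
... | k , pk , min = suc k , pk , λ where
  zero    p0 → contradiction p0 ¬p0
  (suc m) pm → s≤s (min m pm)

greatest : ∀ {P : Pred ℕ 0ℓ} → Decidable₁ P → P 0 → ∀ n → (∀ m → P m → m ≤ n) → ∃ (IsGreatest P)
greatest P? p0 zero    bound = 0 , p0 , bound
greatest {P} P? p0 (suc n) bound with P? (suc n)
... | yes p = suc n , p , bound
... | no ¬p = greatest P? p0 n bound′
  where
  bound′ : ∀ m → P m → m ≤ n
  bound′ m pm with m≤n⇒m<n∨m≡n (bound m pm)
  ... | inj₁ (s≤s m≤n) = m≤n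
  ... | inj₂ refl      = contradiction pm ¬p

module _ (G : FiniteGraph) where
  open FiniteGraph G
  open Inverse finite using (to; from; strictlyInverseʳ)

  to-injective : ∀ {u v} → to u ≡ to v → u ≡ v
  to-injective {u} {v} eq = trans (sym (strictlyInverseʳ u)) (trans (cong from eq) (strictlyInverseʳ v))

  colourable? : Decidable₁ (Colourable G)
  colourable? k = map′ fwd bwd (any? λ i → all? λ a → all? λ b →
                    adj? (from a) (from b) →-dec ¬? (finToFun {k} {order} i a ≟ᶠ finToFun i b))
    where
    Coded : Fin (k ^ order) → Set
    Coded i = ∀ a b → Adj (from a) (from b) → finToFun {k} {order} i a ≢ finToFun i b

    fwd : ∃ Coded → Colourable G k
    fwd (i , p) = finToFun i ∘ to , λ u v uv → p (to u) (to v)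
      (subst₂ Adj (sym (strictlyInverseʳ u)) (sym (strictlyInverseʳ v)) uv)

    bwd : Colourable G k → ∃ Coded
    bwd (c , p) = funToFin (c ∘ from) , λ a b ab eq → p (from a) (from b) ab
      (trans (sym (finToFun-funToFin (c ∘ from) a)) (trans eq (finToFun-funToFin (c ∘ from) b)))

  hasClique? : Decidable₁ (HasClique G)
  hasClique? k = map′ fwd bwd (any? λ x → all? λ i → all? λ j →
                   ¬? (i ≟ᶠ j) →-dec adj? (from (finToFun {order} {k} x i)) (from (finToFun x j)))
    where
    Coded : Fin (order ^ k) → Set
    Coded x = ∀ i j → i ≢ j → Adj (from (finToFun {order} {k} x i)) (from (finToFun x j))

    fwd : ∃ Coded → HasClique G k
    fwd (x , p) = from ∘ finToFun x , p

    bwd : HasClique G k → ∃ Coded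
    bwd (q , p) = funToFin (to ∘ q) , λ i j i≢j → subst₂ Adj (decode i) (decode j) (p i j i≢j)
      where
      decode : ∀ i → q i ≡ from (finToFun (funToFin (to ∘ q)) i)
      decode i = trans (sym (strictlyInverseʳ (q i))) (cong from (sym (finToFun-funToFin (to ∘ q) i)))

  colourable-order : Colourable G order
  colourable-order = to , λ u v uv eq → irrefl (to-injective eq) uv

  hasClique-bound : ∀ k → HasClique G k → k ≤ order
  hasClique-bound k (q , p) = injective⇒≤ {f = to ∘ q} inj
    where
    inj : ∀ {i j} → to (q i) ≡ to (q j) → i ≡ j
    inj {i} {j} eq with i ≟ᶠ j
    ... | yes i≡j = i≡j
    ... | no  i≢j = contradiction (p i j i≢j) (irrefl (to-injective eq))

  chromaticNumber : ∃ (IsLeast (Colourable G))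
  chromaticNumber = least colourable? order colourable-order

  cliqueNumber : ∃ (IsGreatest (HasClique G))
  cliqueNumber = greatest hasClique? ((λ ()) , λ ()) order hasClique-bound

  χ : ℕ
  χ = proj₁ chromaticNumber

  ω : ℕ
  ω = proj₁ cliqueNumber

{-# OPTIONS --safe #-}
module Submission where

-- X-freeness says that two disjoint edges which cross (as chords of a circle) are joined by an edge;
-- hence so are any two connected sets that cross.  Induction on the clique number bounds the
-- chromatic number of every neighbourhood, say by m.
--
-- Call (K, Q, W) an r-configuration if K is an r-clique, Q is complete to K, and every vertex of W
-- has a neighbour in Q.  We show by induction on r that large chromatic number forces
-- r-configurations with W of large chromatic number; K and a vertex of Q form an (r+1)-clique.
-- r = 1: in a distance layer from a root take an edge uv spanning a large part of the layer; a path
-- from a spanned vertex to the root crosses uv, so its parent is adjacent to u or v.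
-- r → r+1: suppose there is no (r+1)-configuration with W large.  A vertex h kills a cover Q at w if
-- it is adjacent to all neighbours of w in Q; so no (r+1)-clique kills a cover on a large set.
--  * Two covers of A anchored at non-adjacent vertices a and b, each anchor missing the other cover,
--    cannot be thin (no vertex of one sees much of A through the other): the paths y-x-a and y'-p-b
--    cross when y precedes y', so the (r+1)-cliques in one half of A would kill a cover of the other half.
--  * If every r-configuration inside A kills a given cover of A, then nested configurations kill
--    each other's covers, whose vertices must then sit close to the vertices they dominate, and
--    a path through the clique of the innermost one crosses a path to the anchor of the previous one.
--  * Otherwise one finds arbitrarily many covers, pairwise not killed, and picks from them, one cover
--    at a time, the vertices of an (r+1)-clique complete to the last cover.

open import Defs
open import Data.Bool using (Bool; true; false; not; _xor_)
open import Data.Bool.Properties using (xor-assoc; xor-comm)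
open import Data.Empty using (⊥; ⊥-elim)
open import Data.Fin using (fromℕ<) renaming (zero to fzero; suc to fsuc)
open import Data.Fin.Properties using (fromℕ<-injective)
open import Data.List using (List; []; _∷_; length; take; _++_; tabulate; lookup)
open import Data.List.Properties using (length-take; length-++)
open import Data.List.Membership.Propositional using (_∈_; find; lose)
open import Data.List.Membership.Propositional.Properties using (∈-tabulate⁺; ∈-lookup)
open import Data.List.Relation.Binary.Pointwise using (Pointwise; []; _∷_)
import Data.List.Relation.Binary.Sublist.Propositional as Sub
open import Data.List.Relation.Binary.Sublist.Propositional.Properties using (All-resp-⊆)
open import Data.List.Relation.Unary.All as All using (All; []; _∷_)
import Data.List.Relation.Unary.All.Properties as Allₚ
open import Data.List.Relation.Unary.AllPairs as AllPairs using (AllPairs; []; _∷_)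
import Data.List.Relation.Unary.AllPairs.Properties as AllPairsₚ
open import Data.List.Relation.Unary.Any as Any using (Any; here; there)
import Data.List.Relation.Unary.Any.Properties as Anyₚ
open import Data.Nat using (ℕ; zero; suc; _+_; _*_; _≤_; _<_; z≤n; s≤s; _<?_; _≤?_; _≤′_; ≤′-refl; ≤′-step)
open import Data.Nat.Properties
open import Data.Product using (Σ; ∃; _×_; _,_; proj₁; proj₂)
open import Data.Sum using (_⊎_; inj₁; inj₂)
open import Data.Unit using (⊤; tt)
open import Function.Bundles using (Inverse)
open import Level using (Level)
open import Relation.Binary.Definitions using (tri<; tri≈; tri>)
open import Relation.Binary.PropositionalEquality using (_≡_; _≢_; refl; sym; trans; cong; cong₂; subst)
open import Relation.Binary.Structures using (IsStrictTotalOrder)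
open import Relation.Nullary using (¬_; Dec; yes; no; does)
open import Relation.Nullary.Decidable using (dec-true; dec-false; decidable-stable; from-yes; _×-dec_)

private variable
  ℓ ℓ₁ ℓ₂ ℓ₃ : Level

-- Classical reasoning under double negation

em : (P : Set ℓ) → ¬ ¬ (P ⊎ ¬ P)
em P k = k (inj₂ λ p → k (inj₁ p))

least-switch : (P : ℕ → Set) → ¬ P 0 → ∀ n → P n → ¬ ¬ (∃ λ k → ¬ P k × P (suc k))
least-switch P p0 zero    pn k = p0 pn
least-switch P p0 (suc n) pn k = em (P n) λ where
  (inj₁ p)  → least-switch P p0 n p k
  (inj₂ ¬p) → k (n , ¬p , pn)

quad : ℕ → ℕ
quad n = (n + n) + (n + n)

quads : ℕ → ℕ → ℕ
quads zero    n = n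
quads (suc r) n = quad (quads r n)

-- The order is a numbering, so comparisons are Booleans; the graphs met in the induction share one
-- vertex type and differ only in adjacency.
record XGraph : Set₁ where
  field
    V       : Set
    pos     : V → ℕ
    pos-inj : ∀ {u v} → pos u ≡ pos v → u ≡ v
    top     : ℕ
    pos<top : ∀ v → pos v < top
    -- Finiteness of V: existential bounds over all vertices can be made uniform (classically).
    unif    : (P : ℕ → V → Set) → (∀ {i j v} → i ≤ j → P i v → P j v) →
              (∀ v → ¬ ¬ (∃ λ i → P i v)) → ¬ ¬ (∃ λ i → ∀ v → P i v)
    Adj     : V → V → Set
    adj?    : ∀ u v → Dec (Adj u v)
    symm    : ∀ {u v} → Adj u v → Adj v u
    irr     : ∀ {v} → ¬ Adj v v

  lt : V → V → Bool
  lt u v = does (pos u <? pos v)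

  -- For distinct vertices: the chords uv and ta cross.  As a parity, Sep is additive along walks
  -- in both pairs of arguments.
  Sep : V → V → V → V → Bool
  Sep u v t a = (lt u t xor lt u a) xor (lt v t xor lt v a)

  field
    xfree : ∀ {u v t a} → Adj u v → Adj t a → ¬ Adj u t → ¬ Adj u a → ¬ Adj v t → ¬ Adj v a →
            Sep u v t a ≡ false

-- Chromatic largeness, covers and kills

module Graph (G : XGraph) where
  open XGraph G

  Pd : Set₁
  Pd = V → Set

  _⊆_ : Pd → Pd → Set
  S ⊆ S' = ∀ {v} → S v → S' v

  -- Double negation shift over the vertices: `unif` for a property constant in the index.
  choose : (P : V → Set) → (∀ v → ¬ ¬ P v) → ¬ ¬ (∀ v → P v)
  choose P h k = unif (λ _ → P) (λ _ p → p) (λ v n → h v λ p → n (0 , p)) λ (_ , f) → k f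

  decide-set : (S : Pd) → ¬ ¬ (∀ v → Dec (S v))
  decide-set S = choose (λ v → Dec (S v)) λ v k → em (S v) λ where
    (inj₁ s) → k (yes s)
    (inj₂ n) → k (no n)

  stable : ∀ {u v} → ¬ ¬ Adj u v → Adj u v
  stable {u} {v} = decidable-stable (adj? u v)

  lt-true : ∀ {u v} → pos u < pos v → lt u v ≡ true
  lt-true {u} {v} p = dec-true (pos u <? pos v) p

  lt-false : ∀ {u v} → pos v ≤ pos u → lt u v ≡ false
  lt-false {u} {v} p = dec-false (pos u <? pos v) (≤⇒≯ p)

  -- Large n S means that S has chromatic number > n.  Subsets are arbitrary predicates; as the final
  -- inequality is decidable, all existence statements are only proved doubly negated.
  Col : ℕ → Pd → Set
  Col n S = Σ (V → ℕ) λ f → (∀ v → S v → f v < n) × (∀ u v → S u → S v → Adj u v → f u ≢ f v)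

  Large : ℕ → Pd → Set
  Large n S = ¬ Col n S

  grow : ∀ {n S S'} → S ⊆ S' → Large n S → Large n S'
  grow s l (f , b , p) = l (f , (λ v x → b v (s x)) , λ u v x y → p u v (s x) (s y))

  weaken : ∀ {n n' S} → n ≤ n' → Large n' S → Large n S
  weaken le l (f , b , p) = l (f , (λ v x → ≤-trans (b v x) le) , p)

  resize : ∀ {n n' S} → n ≡ n' → Large n S → Large n' S
  resize refl l = l

  inhabited : ∀ {n S} → Large n S → ¬ ¬ ∃ S
  inhabited l k = l ((λ _ → 0) , (λ v s → ⊥-elim (k (v , s))) , λ u _ s → ⊥-elim (k (u , s)))

  -- Subadditivity: colours below `a` go to `S₁`, colours shifted by `a` to the rest, which lies in
  -- `S₂`.
  cut : ∀ a {b S} S₁ {S₂} → Large (a + b) S → (∀ {v} → S v → ¬ ¬ (S₁ v ⊎ S₂ v)) →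
        ¬ Large a S₁ → Large b S₂
  cut a {b} {S} S₁ {S₂} l h ¬l (g , gb , gp) = ¬l λ (f , fb , fp) →
    choose (λ v → S v → S₁ v ⊎ (¬ S₁ v × S₂ v)) (λ v k → em (S₁ v) λ where
        (inj₁ s₁)  → k λ _ → inj₁ s₁
        (inj₂ ¬s₁) → k λ s → ⊥-elim (h s λ where
          (inj₁ s₁) → ¬s₁ s₁
          (inj₂ s₂) → k λ _ → inj₂ (¬s₁ , s₂)))
      λ d → choose (λ v → S₁ v ⊎ ¬ S₁ v) (λ v → em (S₁ v)) λ e →
      let c : V → ℕ
          c v = pick (e v) (f v) (g v)
      in l (c , (λ v s → bound v s (d v s) (e v) (fb v) (gb v)) ,
             λ u v su sv uv → proper u v (d u su) (d v sv) (e u) (e v) (fb u) (fb v) (fp u v) (gp u v) uv)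
    where
    pick : ∀ {v} → S₁ v ⊎ ¬ S₁ v → ℕ → ℕ → ℕ
    pick (inj₁ _) x y = x
    pick (inj₂ _) x y = a + y
    bound : ∀ v {x y} → S v → S₁ v ⊎ (¬ S₁ v × S₂ v) → (e : S₁ v ⊎ ¬ S₁ v) →
            (S₁ v → x < a) → (S₂ v → y < b) → pick e x y < a + b
    bound v s d (inj₁ s₁) p q = ≤-trans (p s₁) (m≤m+n a b)
    bound v s (inj₁ s₁) (inj₂ ¬s₁) p q = ⊥-elim (¬s₁ s₁)
    bound v s (inj₂ (_ , s₂)) (inj₂ ¬s₁) p q = +-monoʳ-< a (q s₂)
    proper : ∀ u v {x y x' y'} → S₁ u ⊎ (¬ S₁ u × S₂ u) → S₁ v ⊎ (¬ S₁ v × S₂ v) →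
             (e : S₁ u ⊎ ¬ S₁ u) (e' : S₁ v ⊎ ¬ S₁ v) → (S₁ u → x < a) → (S₁ v → x' < a) →
             (S₁ u → S₁ v → Adj u v → x ≢ x') → (S₂ u → S₂ v → Adj u v → y ≢ y') →
             Adj u v → pick e x y ≢ pick e' x' y'
    proper u v d d' (inj₁ s) (inj₁ s') b b' p q uv = p s s' uv
    proper u v {x} {y} {x'} {y'} d d' (inj₁ s) (inj₂ t') b b' p q uv eq =
      <⇒≢ (≤-trans (b s) (m≤m+n a y')) eq
    proper u v {x} {y} {x'} {y'} d d' (inj₂ t) (inj₁ s') b b' p q uv eq =
      <⇒≢ (≤-trans (b' s') (m≤m+n a y)) (sym eq)
    proper u v (inj₁ s) d' (inj₂ t) (inj₂ t') b b' p q uv = ⊥-elim (t s)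
    proper u v (inj₂ _) (inj₁ s') (inj₂ t) (inj₂ t') b b' p q uv = ⊥-elim (t' s')
    proper u v (inj₂ (_ , s)) (inj₂ (_ , s')) (inj₂ t) (inj₂ t') b b' p q uv eq = q s s' uv (+-cancelˡ-≡ a _ _ eq)

  small-∪ : ∀ {a b S} S₁ S₂ → (∀ {v} → S v → ¬ ¬ (S₁ v ⊎ S₂ v)) →
            ¬ Large a S₁ → ¬ Large b S₂ → ¬ Large (a + b) S
  small-∪ {a} S₁ S₂ h s₁ s₂ l = s₂ (cut a S₁ l h s₁)

  drop : ∀ a {b S} E → ¬ Large a E → Large (a + b) S → Large b (λ v → S v × ¬ E v)
  drop a {b} {S} E sm l = cut a E l (λ {v} s k → em (E v) λ where
    (inj₁ e)  → k (inj₁ e)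
    (inj₂ ¬e) → k (inj₂ (s , ¬e))) sm

  drop-all : ∀ {X : Set} (E : X → Pd) {e c S} (C : List X) → All (λ y → ¬ Large e (E y)) C →
             Large (length C * e + c) S → Large c (λ v → S v × All (λ y → ¬ E y v) C)
  drop-all E [] [] l = grow (λ s → s , []) l
  drop-all E {e} {c} {S} (y ∷ C) (sm ∷ sms) l =
    grow (λ ((s , ¬e) , a) → s , ¬e ∷ a)
      (drop-all E C sms (drop e (E y) sm (resize (+-assoc e (length C * e) c) l)))

  pigeon : ∀ {X : Set} (E : X → Pd) {e S} (C : List X) → (∀ {v} → S v → ¬ ¬ Any (λ y → E y v) C) →
           Large (length C * e) S → ¬ ¬ Any (λ y → Large e (λ v → S v × E y v)) C
  pigeon E {e} {S} C h l k = inhabited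
    (drop-all (λ y v → S v × E y v) {e} {0} C (none C k)
      (resize (sym (+-identityʳ (length C * e))) l))
    λ (v , s , a) → h s λ any → clash s a any
    where
    none : ∀ C → ¬ Any (λ y → Large e (λ v → S v × E y v)) C →
           All (λ y → ¬ Large e (λ v → S v × E y v)) C
    none [] k = []
    none (y ∷ C) k = (λ l → k (here l)) ∷ none C (λ a → k (there a))
    clash : ∀ {C v} → S v → All (λ y → ¬ (S v × E y v)) C → ¬ Any (λ y → E y v) C
    clash s (n ∷ _) (here e)  = n (s , e)
    clash s (_ ∷ a) (there i) = clash s a i

  Cov : Pd → Pd
  Cov Q w = ∃ λ x → Q x × Adj x w

  Kill : Pd → V → V → Set
  Kill Q h w = ∀ x → Q x → Adj x w → Adj x h

  -- All of A lies on one side of a, so crossing an edge at a is decided by the order within A.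
  OneSide : Pd → V → Set
  OneSide A a = Σ Bool λ σ → Σ Bool λ τ → ∀ {w} → A w → lt w a ≡ σ × lt a w ≡ τ

  side-⊆ : ∀ {A A' : Pd} {v} → A ⊆ A' → OneSide A' v → OneSide A v
  side-⊆ s (σ , τ , o) = σ , τ , λ w → o (s w)

  halve : ∀ n {A} (β : V → Bool) → Large (n + n) A → ¬ ¬ (∃ λ σ → Large n (λ v → A v × β v ≡ σ))
  halve n {A} β l k = k (false , cut n (λ v → A v × β v ≡ true) l (λ {v} a k' → k' (side (β v) refl a))
    λ l' → k (true , l'))
    where
    side : ∀ {v} b → β v ≡ b → A v → (A v × β v ≡ true) ⊎ (A v × β v ≡ false)
    side true  e a = inj₁ (a , e)
    side false e a = inj₂ (a , e)

  -- Two halvings, one for each Boolean recorded by `OneSide`.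
  one-side : ∀ n {A} a → Large (quad n) A → ¬ ¬ (Σ Pd λ A' → A' ⊆ A × Large n A' × OneSide A' a)
  one-side n {A} a l k = halve (n + n) (λ w → lt w a) l λ (σ , l₁) → halve n (λ w → lt a w) l₁ λ (τ , l₂) →
    k (_ , (λ ((x , _) , _) → x) , l₂ , σ , τ , λ ((_ , e) , e') → e , e')

  one-sides : ∀ n {A} (K : List V) → Large (quads (length K) n) A →
              ¬ ¬ (Σ Pd λ A' → A' ⊆ A × Large n A' × All (OneSide A') K)
  one-sides n [] l k = k (_ , (λ x → x) , l , [])
  one-sides n (a ∷ K) l k = one-side (quads (length K) n) a l λ (A₁ , s₁ , l₁ , σ , τ , o) →
    one-sides n K l₁ λ (A₂ , s₂ , l₂ , os) → k (A₂ , (λ x → s₁ (s₂ x)) , l₂ , (σ , τ , λ x → o (s₂ x)) ∷ os)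

  -- Walks and crossing parity

  data Walk (P : Pd) : V → V → Set where
    end  : ∀ {v} → P v → Walk P v v
    step : ∀ {u v w} → P u → Adj u v → Walk P v w → Walk P u w

  sep-clash : ∀ {b} → b ≡ true → b ≢ false
  sep-clash refl ()

  xor-same : ∀ x → x xor x ≡ false
  xor-same true  = refl
  xor-same false = refl

  xor-swap : ∀ a b c d → (a xor b) xor (c xor d) ≡ (a xor c) xor (b xor d)
  xor-swap false false false false = refl
  xor-swap false false false true = refl
  xor-swap false false true false = refl
  xor-swap false false true true = refl
  xor-swap false true false false = refl
  xor-swap false true false true = refl
  xor-swap false true true false = refl
  xor-swap false true true true = refl
  xor-swap true false false false = refl
  xor-swap true false false true = refl
  xor-swap true false true false = refl
  xor-swap true false true true = refl
  xor-swap true true false false = refl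
  xor-swap true true false true = refl
  xor-swap true true true false = refl
  xor-swap true true true true = refl

  xor-chain : ∀ {x y z} → x xor y ≡ false → y xor z ≡ false → x xor z ≡ false
  xor-chain {true}  {true}  {true}  p q = refl
  xor-chain {false} {false} {false} p q = refl

  head-in : ∀ {P u v} → Walk P u v → P u
  head-in (end p)      = p
  head-in (step p _ _) = p

  sep-left : ∀ {u v w t a} → Sep u v t a ≡ false → Sep v w t a ≡ false → Sep u w t a ≡ false
  sep-left {u} {v} {w} {t} {a} = xor-chain {lt u t xor lt u a} {lt v t xor lt v a}

  sep-right : ∀ {u v t x a} → Sep u v t x ≡ false → Sep u v x a ≡ false → Sep u v t a ≡ false
  sep-right {u} {v} {t} {x} {a} p q =
    trans (xor-swap (lt u t) (lt u a) (lt v t) (lt v a))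
      (xor-chain {lt u t xor lt v t} {lt u x xor lt v x}
        (trans (sym (xor-swap (lt u t) (lt u x) (lt v t) (lt v x))) p)
        (trans (sym (xor-swap (lt u x) (lt u a) (lt v x) (lt v a))) q))

  -- X-freeness gives parity `false` for each edge of the walk, and `Sep` adds up along it.
  edge-walk : ∀ {R : Pd} {u v t a} → Adj u v → Walk R t a →
              (∀ {x} → R x → ¬ Adj u x × ¬ Adj v x) → Sep u v t a ≡ false
  edge-walk {u = u} {v} {t} uv (end _) nt
    rewrite xor-same (lt u t) | xor-same (lt v t) = refl
  edge-walk uv (step r tt' w) nt =
    sep-right
      (xfree uv tt' (proj₁ (nt r)) (proj₁ (nt (head-in w))) (proj₂ (nt r)) (proj₂ (nt (head-in w))))
      (edge-walk uv w nt)

  edge-path : ∀ {u v t x a} → Adj u v → Adj t x → Adj x a → ¬ Adj u t → ¬ Adj u x → ¬ Adj u a →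
              ¬ Adj v t → ¬ Adj v x → ¬ Adj v a → Sep u v t a ≡ false
  edge-path uv tx xa ut ux ua vt vx va =
    sep-right (xfree uv tx ut ux vt vx) (xfree uv xa ux ua vx va)

  -- Consecutive blocks of large chromatic number

  bound-all : ∀ (S : Pd) {p} → top ≤ p → ∀ {v} → S v → S v × pos v < p
  bound-all S le {v} s = s , ≤-trans (pos<top v) le

  single-small : ∀ p → ¬ Large 1 (λ v → pos v ≡ p)
  single-small p l = l ((λ _ → 0) , (λ _ _ → s≤s z≤n) , λ u v eu ev uv _ →
    irr (subst (Adj u) (sym (pos-inj (trans eu (sym ev)))) uv))

  -- Where the prefix becomes large only one vertex is added, hence at most one colour.
  first-block : ∀ β {S} → Large β S →
                ¬ ¬ (∃ λ q → Large β (λ v → S v × pos v < q) × ¬ Large (suc β) (λ v → S v × pos v < q))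
  first-block β {S} l k =
    least-switch (λ q → Large β (λ v → S v × pos v < q)) (λ l₀ → inhabited l₀ λ ()) top
      (grow (bound-all S ≤-refl) l)
      λ (q , sm , lg) → k (suc q , lg ,
        small-∪ (λ v → pos v ≡ q) (λ v → S v × pos v < q) (λ {v} (s , lt) k' → k' (split s lt)) (single-small q) sm)
    where
    split : ∀ {v q} → S v → pos v < suc q → pos v ≡ q ⊎ (S v × pos v < q)
    split s (s≤s le) with m≤n⇒m<n∨m≡n le
    ... | inj₁ lt = inj₂ (s , lt)
    ... | inj₂ eq = inj₁ eq

  Block : Pd → ℕ → ℕ → Pd
  Block S p q v = S v × p ≤ pos v × pos v < q

  -- Each first block split off costs at most `β + 1` colours, so the remainder keeps the share of
  -- the other blocks.
  blocks : ∀ n β {S} s → (∀ {v} → S v → s ≤ pos v) → Large (n * suc β) S →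
           ¬ ¬ (Σ (ℕ → ℕ) λ p → p 0 ≡ s × (∀ i → p i ≤ p (suc i)) × (∀ i → i < n → Large β (Block S (p i) (p (suc i)))))
  blocks zero β s lo l k = k ((λ _ → s) , refl , (λ _ → ≤-refl) , λ i ())
  blocks (suc n) β {S} s lo l k = first-block β (weaken (≤-trans (n≤1+n β) (m≤m+n (suc β) _)) l) λ (q , lg , sm) →
    blocks n β {λ v → S v × q ≤ pos v} q proj₂
      (cut (suc β) (λ v → S v × pos v < q) l (λ {v} x k' → k' (side x (pos v <? q))) sm)
      λ (p , p0 , mono , bl) →
        k (thr p , refl , (λ { zero → subst (s ≤_) (sym p0) (s≤q lg) ; (suc i) → mono i }) , λ where
          zero _ → grow (λ (x , lt) → x , lo x , subst (_ <_) (sym p0) lt) lg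
          (suc i) (s≤s lt) → grow (λ ((x , _) , r) → x , r) (bl i lt))
    where
    thr : (ℕ → ℕ) → ℕ → ℕ
    thr p zero = s
    thr p (suc i) = p i
    side : ∀ {v q} → S v → Dec (pos v < q) → (S v × pos v < q) ⊎ (S v × q ≤ pos v)
    side x (yes lt) = inj₁ (x , lt)
    side x (no ¬lt) = inj₂ (x , ≮⇒≥ ¬lt)
    s≤q : ∀ {q} → Large β (λ v → S v × pos v < q) → s ≤ q
    s≤q {q} lg with s ≤? q
    ... | yes le = le
    ... | no ¬le = ⊥-elim (inhabited lg λ (v , x , lt) → ¬le (≤-trans (lo x) (<⇒≤ lt)))

  -- Configurations and the statements of the induction

  record Conf (r c : ℕ) (A : Pd) : Set₁ where
    field
      K     : List V
      len   : length K ≡ r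
      clq   : AllPairs Adj K
      K⊆A   : All A K
      Q W   : Pd
      Q⊆A   : Q ⊆ A
      W⊆A   : W ⊆ A
      QK    : ∀ {x} → Q x → All (Adj x) K
      cov   : ∀ {w} → W w → ¬ ¬ Cov Q w
      anti  : ∀ {w} → W w → All (λ h → ¬ Adj h w) K
      sides : All (OneSide W) K
      large : Large c W

  Sparse : ℕ → Set
  Sparse m = ∀ v → ¬ Large m (Adj v)

  Unavoidable : ℕ → (ℕ → ℕ) → Set₁
  Unavoidable r φ = ∀ c A → Large (φ c) A → ¬ ¬ Conf r c A

  -- Assumed for size r+1 in the induction step: a fan over a large set could be normalised to a
  -- configuration.
  NoFan : ℕ → ℕ → Set₁
  NoFan r c = ∀ (C : List V) (Q W : Pd) → length C ≡ r → AllPairs Adj C → (∀ {x} → Q x → All (Adj x) C) →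
              (∀ {w} → W w → ¬ ¬ Cov Q w) → ¬ Large c W

  CliqueFree : ℕ → Pd → Set
  CliqueFree k A = ∀ K → length K ≡ suc k → AllPairs Adj K → ¬ All A K

Unav : ℕ → ℕ → Set₁
Unav r m = Σ (ℕ → ℕ) λ φ → (G : XGraph) → Graph.Sparse G m → Graph.Unavoidable G r φ

-- Distance layers and 1-configurations

-- `c₂` pays for the neighbourhoods of both ends of an edge and for two candidate configurations,
-- `f₁` for two palettes, `f₀` for the first two layers and the two sides of the root.
module ControlBounds (m c : ℕ) where
  c₂ f₁ f₀ : ℕ
  c₂ = m + (m + (quad c + quad c))
  f₁ = suc c₂ + suc c₂
  f₀ = suc (m + (f₁ + f₁))

module Control (G : XGraph) where
  open XGraph G
  open Graph G

  Proper : (V → ℕ) → Pd → Set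
  Proper f S = ∀ u v → S u → S v → Adj u v → f u ≢ f v

  mix : ∀ (S : Pd) (f g : V → ℕ) → ¬ ¬ (Σ (V → ℕ) λ h → (∀ v → S v → h v ≡ f v) × (∀ v → ¬ S v → h v ≡ g v))
  mix S f g k = choose (λ v → S v ⊎ ¬ S v) (λ v → em (S v)) λ d →
    k ((λ v → pick v (d v)) , (λ v s → pickˡ v (d v) s) , λ v n → pickʳ v (d v) n)
    where
    pick : ∀ v → S v ⊎ ¬ S v → ℕ
    pick v (inj₁ _) = f v
    pick v (inj₂ _) = g v
    pickˡ : ∀ v d → S v → pick v d ≡ f v
    pickˡ v (inj₁ _) s = refl
    pickˡ v (inj₂ n) s = ⊥-elim (n s)
    pickʳ : ∀ v d → ¬ S v → pick v d ≡ g v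
    pickʳ v (inj₁ s) n = ⊥-elim (n s)
    pickʳ v (inj₂ _) n = refl

  -- Both colourings share one palette, with `S₁` taking precedence; the last two outputs let
  -- palette invariants be carried on.
  glue : ∀ {n} {S₁ S₂ S : Pd} (f g : V → ℕ) → (∀ v → S₁ v → f v < n) → (∀ v → S₂ v → g v < n) → Proper f S₁ → Proper g S₂ →
         (∀ u v → S₁ u → S₂ v → ¬ S₁ v → Adj u v → f u ≢ g v) → (∀ {v} → S v → S₁ v ⊎ S₂ v) →
         ¬ ¬ (Σ (V → ℕ) λ h → (∀ v → S v → h v < n) × Proper h S × (∀ v → S₁ v → h v ≡ f v) × (∀ v → ¬ S₁ v → h v ≡ g v))
  glue {n} {S₁} {S₂} {S} f g fb gb fp gp fg sub k =
    mix S₁ f g λ (h , hf , hg) → choose (λ v → S v → S₁ v ⊎ (¬ S₁ v × S₂ v)) (λ v k' → em (S₁ v) λ where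
      (inj₁ s) → k' λ _ → inj₁ s
      (inj₂ n) → k' λ s → right (sub s) n) λ d →
    k (h , (λ v s → bound h hf hg v (d v s)) , (λ u v su sv → proper h hf hg u v (d u su) (d v sv)) , hf , hg)
    where
    right : ∀ {v} → S₁ v ⊎ S₂ v → ¬ S₁ v → S₁ v ⊎ (¬ S₁ v × S₂ v)
    right (inj₁ s) n = inj₁ s
    right (inj₂ s) n = inj₂ (n , s)
    module _ (h : V → ℕ) (hf : ∀ v → S₁ v → h v ≡ f v) (hg : ∀ v → ¬ S₁ v → h v ≡ g v) where
      bound : ∀ v → S₁ v ⊎ (¬ S₁ v × S₂ v) → h v < n
      bound v (inj₁ s) = subst (_< n) (sym (hf v s)) (fb v s)
      bound v (inj₂ (n' , s)) = subst (_< n) (sym (hg v n')) (gb v s)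
      proper : ∀ u v → S₁ u ⊎ (¬ S₁ u × S₂ u) → S₁ v ⊎ (¬ S₁ v × S₂ v) → Adj u v → h u ≢ h v
      proper u v (inj₁ s) (inj₁ t) uv e = fp u v s t uv (trans (sym (hf u s)) (trans e (hf v t)))
      proper u v (inj₁ s) (inj₂ (n , t)) uv e = fg u v s t n uv (trans (sym (hf u s)) (trans e (hg v n)))
      proper u v (inj₂ (n , t)) (inj₁ s) uv e = fg v u s t n (symm uv) (trans (sym (hf v s)) (trans (sym e) (hg u n)))
      proper u v (inj₂ (n , s)) (inj₂ (n' , t)) uv e = gp u v s t uv (trans (sym (hg u n)) (trans e (hg v n')))

  shift : ℕ → Bool → ℕ → ℕ
  shift f false x = x
  shift f true  x = f + x

  Pal : ℕ → Bool → ℕ → Set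
  Pal f false x = x < f
  Pal f true  x = f ≤ x

  pal-shift : ∀ f b {x} → x < f → Pal f b (shift f b x)
  pal-shift f false p = p
  pal-shift f true {x} p = m≤m+n f x

  shift-bound : ∀ f b {x} → x < f → shift f b x < f + f
  shift-bound f false p = ≤-trans p (m≤m+n f f)
  shift-bound f true p = +-monoʳ-< f p

  shift-inj : ∀ f b {x y} → shift f b x ≡ shift f b y → x ≡ y
  shift-inj f false e = e
  shift-inj f true e = +-cancelˡ-≡ f _ _ e

  pal-disjoint : ∀ f b {x y} → Pal f b x → Pal f (not b) y → x ≢ y
  pal-disjoint f false p q refl = <⇒≱ p q
  pal-disjoint f true p q refl = <⇒≱ q p

  -- Colouring by distance layers

  module Layers (A : Pd) where
    Ball : V → ℕ → Pd
    Ball v₀ zero    v = v ≡ v₀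
    Ball v₀ (suc i) v = Ball v₀ i v ⊎ (A v × ∃ λ u → Ball v₀ i u × Adj u v)

    Layer : V → ℕ → Pd
    Layer v₀ zero    = Ball v₀ zero
    Layer v₀ (suc i) v = Ball v₀ (suc i) v × ¬ Ball v₀ i v

    Reach : V → Pd
    Reach v₀ v = ∃ λ i → Ball v₀ i v

    ball-mono : ∀ {v₀ i j v} → i ≤ j → Ball v₀ i v → Ball v₀ j v
    ball-mono {i = i} {j} le b = go (≤⇒≤′ le) b
      where
      go : ∀ {v₀ j v} → i ≤′ j → Ball v₀ i v → Ball v₀ j v
      go ≤′-refl b = b
      go (≤′-step l) b = inj₁ (go l b)

    ball⊆A : ∀ {v₀} i {v} → A v₀ → Ball v₀ i v → A v
    ball⊆A zero    a refl = a
    ball⊆A (suc i) a (inj₁ b) = ball⊆A i a b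
    ball⊆A (suc i) a (inj₂ (a' , _)) = a'

    layer⊆ball : ∀ {v₀} i {v} → Layer v₀ i v → Ball v₀ i v
    layer⊆ball zero    l = l
    layer⊆ball (suc i) l = proj₁ l

    outer : ∀ {v₀} i {u v} → A v → Ball v₀ i u → ¬ Ball v₀ i v → Adj u v → ¬ ¬ Layer v₀ i u
    outer zero    a b nb uv k = k b
    outer (suc i) {u} a b nb uv k = em (Ball _ i u) λ where
      (inj₁ b') → nb (inj₂ (a , u , b' , uv))
      (inj₂ n)  → k (b , n)

    module _ (f : ℕ) (small : ∀ v₀ i → A v₀ → ¬ Large f (Layer v₀ i)) where

      -- Layers alternate between two palettes: by `outer` a new layer has edges into the ball only
      -- at the layer just before it, whose palette `b` is recorded.
      ball-colour : ∀ {v₀} → A v₀ → ∀ D → ¬ ¬ (Σ (V → ℕ) λ g → (∀ v → Ball v₀ D v → g v < f + f) × Proper g (Ball v₀ D) ×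
                    Σ Bool λ b → ∀ v → Layer v₀ D v → Pal f b (g v))
      ball-colour {v₀} a zero k = small v₀ 0 a λ (g , gb , gp) →
        k (g , (λ v x → ≤-trans (gb v x) (m≤m+n f f)) , gp , false , gb)
      ball-colour {v₀} a (suc D) k = ball-colour a D λ (g , gb , gp , b , pal) →
        small v₀ (suc D) a λ (h , hb , hp) →
        glue {S₁ = Ball v₀ D} {S₂ = Layer v₀ (suc D)} {S = λ v → Ball v₀ D v ⊎ Layer v₀ (suc D) v} g (λ v → shift f (not b) (h v)) gb
          (λ v l → shift-bound f (not b) (hb v l)) gp (λ u v lu lv uv e → hp u v lu lv uv (shift-inj f (not b) e))
          (λ u v bu lv nbv uv e → outer D (ball⊆A (suc D) a (proj₁ lv)) bu nbv uv λ lu →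
             pal-disjoint f b (pal u lu) (pal-shift f (not b) (hb v lv)) e)
          (λ s → s)
        λ (g' , gb' , gp' , _ , eq) →
        choose (λ v → Ball v₀ (suc D) v → Ball v₀ D v ⊎ Layer v₀ (suc D) v)
          (λ v k' → em (Ball v₀ D v) λ { (inj₁ x) → k' λ _ → inj₁ x ; (inj₂ n) → k' λ x → inj₂ (x , n) }) λ cv →
        k (g' , (λ v x → gb' v (cv v x)) , (λ u v x y → gp' u v (cv u x) (cv v y)) , not b ,
           λ v (x , n) → subst (Pal f (not b)) (sym (eq v n)) (pal-shift f (not b) (hb v (x , n))))

      reach-colour : ∀ {v₀} → A v₀ → ¬ Large (f + f) (Reach v₀)
      reach-colour {v₀} a l =
        -- Finiteness turns the component into a single ball.
        unif (λ i v → Reach v₀ v → Ball v₀ i v) (λ le h x → ball-mono le (h x))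
          (λ v k → em (Reach v₀ v) λ { (inj₁ (i , b)) → k (i , λ _ → b) ; (inj₂ n) → k (0 , λ x → ⊥-elim (n x)) })
        λ (D , all) → ball-colour a D λ (g , gb , gp , _) →
          l (g , (λ v x → gb v (all v x)) , λ u v x y → gp u v (all u x) (all v y))

      Prefix : ℕ → Pd
      Prefix n v = ∃ λ u → pos u < n × A u × Reach u v

      -- Components are added root by root with the same palette; an edge from `Prefix n` into the
      -- next component would put its end into `Prefix n`.
      prefix-colour : ∀ n → ¬ Large (f + f) (Prefix n)
      prefix-colour zero l = inhabited l λ { (_ , _ , () , _) }
      prefix-colour (suc n) l = em (∃ λ u → pos u ≡ n × A u) (λ where
        (inj₂ none) → prefix-colour n (grow (λ (u , p , a , r) → u , ≤∧≢⇒< (≤-pred p) (λ e → none (u , e , a)) , a , r) l)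
        (inj₁ (w , e , a)) → prefix-colour n λ (g , gb , gp) → reach-colour a λ (h , hb , hp) →
          glue {S₁ = Prefix n} {S₂ = Reach w} {S = Prefix (suc n)} g h gb hb gp hp
            (λ u v (u₀ , p , a₀ , i , r) (j , s) nv uv _ → nv (u₀ , p , a₀ , suc i , inj₂ (ball⊆A j a s , u , r , uv)))
            (λ (u , p , a₀ , r) → side e u p a₀ r)
            λ (h' , hb' , hp' , _) → l (h' , hb' , hp'))
        where
        side : ∀ {w v} → pos w ≡ n → ∀ u → pos u < suc n → A u → Reach u v → Prefix n v ⊎ Reach w v
        side {w} {v} e u p a r with m≤n⇒m<n∨m≡n (≤-pred p)
        ... | inj₁ lt = inj₁ (u , lt , a , r)
        ... | inj₂ eq = inj₂ (subst (λ x → Reach x v) (pos-inj (trans eq (sym e))) r)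

      layers-small : ¬ Large (f + f) A
      layers-small l = prefix-colour top (grow (λ {v} a → v , pos<top v , a , 0 , refl) l)

  Between : V → V → Pd
  Between u v t = pos u < pos t × pos t < pos v

  -- McGuinness: if no edge of L spans a part of L of chromatic number > c, colour consecutive
  -- maximal blocks of chromatic number c + 1 alternately with two palettes.
  module _ (c : ℕ) (L : Pd) (short : ∀ u v → L u → L v → Adj u v → ¬ Large c (λ t → L t × Between u v t)) where
    private
      n = suc c

    From : ℕ → Pd
    From p v = L v × p ≤ pos v

    -- Invariant of the sweep: the first block of the suffix, up to `q`, keeps to palette `b`; the
    -- second alternative is the end of the sweep.
    St : ℕ → Bool → Set
    St p b = Σ ℕ λ q → Σ (V → ℕ) λ g → (∀ v → From p v → g v < n + n) × Proper g (From p) ×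
             (∀ v → Block L p q v → Pal n b (g v)) × (Large c (Block L p q) ⊎ (∀ v → L v → pos v < q))

    few : ∀ {p k} → k ≤ p → ¬ Large n (Block L p (suc k))
    few {p} {k} le l = single-small p (weaken (s≤s z≤n) (grow (λ (_ , lo , hi) → ≤-antisym (≤-trans (≤-pred hi) le) lo) l))

    sweep : ∀ fuel p b → top ≤ p + fuel → ¬ ¬ St p b
    sweep fuel p b le k = em (Large n (From p)) (λ where
        (inj₂ ns) → ns λ (g , gb , gp) →
          k (top , (λ v → shift n b (g v)) , (λ v x → shift-bound n b (gb v x)) ,
             (λ u v x y uv e → gp u v x y uv (shift-inj n b e)) ,
             (λ v (x , lo , _) → pal-shift n b (gb v (x , lo))) , inj₂ (λ v _ → pos<top v))
        (inj₁ lg) →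
          least-switch (λ q → Large n (Block L p q)) (λ l → inhabited l λ { (_ , _ , _ , ()) }) top
            (grow (λ {v} (x , lo) → x , lo , pos<top v) lg)
          λ (q , sm , lg') → go fuel le q sm lg' (q ≤? p))
      where
      go : ∀ fuel → top ≤ p + fuel → ∀ q → ¬ Large n (Block L p q) → Large n (Block L p (suc q)) → Dec (q ≤ p) → ⊥
      go fuel le q sm lg (yes q≤p) = few q≤p lg
      go zero le q sm lg (no q≰p) = inhabited lg λ (v , _ , lo , _) →
        <⇒≱ (pos<top v) (≤-trans le (subst (_≤ pos v) (sym (+-identityʳ p)) lo))
      go (suc fuel) le q sm lg (no q≰p) = sm λ (h , hb , hp) →
        sweep fuel q (not b) (≤-trans le (≤-trans (≤-reflexive (+-suc p fuel)) (+-monoˡ-≤ fuel p<q)))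
        λ (q' , g , gb , gp , gpal , gq) →
        glue {S₁ = Block L p q} {S₂ = From q} {S = From p} (λ v → shift n b (h v)) g
          (λ v x → shift-bound n b (hb v x)) gb (λ u v x y uv e → hp u v x y uv (shift-inj n b e)) gp
          (λ u v bu@(lu , _ , u<q) (lv , q≤v) nb uv e → far gq u v lu u<q lv q≤v uv
             λ v<q' → pal-disjoint n b (pal-shift n b (hb u bu)) (gpal v (lv , q≤v , v<q')) e)
          (λ {v} (x , lo) → side x lo (pos v <? q))
        λ (g' , gb' , gp' , eq , _) →
        k (q , g' , gb' , gp' , (λ v x → subst (Pal n b) (sym (eq v x)) (pal-shift n b (hb v x))) ,
           inj₁ (cut 1 (λ v → pos v ≡ q) lg (λ (x , lo , hi) k' → k' (last x lo (m≤n⇒m<n∨m≡n (≤-pred hi)))) (single-small q)))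
        where
        p<q = ≰⇒> q≰p
        last : ∀ {v} → L v → p ≤ pos v → pos v < q ⊎ pos v ≡ q → pos v ≡ q ⊎ Block L p q v
        last x lo (inj₁ l) = inj₂ (x , lo , l)
        last x lo (inj₂ e) = inj₁ e
        side : ∀ {v} → L v → p ≤ pos v → Dec (pos v < q) → Block L p q v ⊎ From q v
        side x lo (yes l) = inj₁ (x , lo , l)
        side x lo (no nl) = inj₂ (x , ≮⇒≥ nl)
        -- An edge jumping over the whole next block would span more than `c` colours, so it ends
        -- inside that block, where the other palette is used.
        far : ∀ {q'} → Large c (Block L q q') ⊎ (∀ v → L v → pos v < q') → ∀ u v → L u → pos u < q → L v → q ≤ pos v →
              Adj u v → (pos v < q' → ⊥) → ⊥
        far (inj₁ l) u v lu u<q lv q≤v uv n =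
          short u v lu lv uv (grow (λ (x , lo , hi) → x , ≤-trans u<q lo , ≤-trans hi (≮⇒≥ n)) l)
        far (inj₂ all) u v lu u<q lv q≤v uv n = n (all v lv)

    short-small : ¬ Large (n + n) L
    short-small l = sweep top 0 false ≤-refl λ (_ , g , gb , gp , _) →
      l (g , (λ v x → gb v (x , z≤n)) , λ u v x y → gp u v (x , z≤n) (y , z≤n))

  -- From a large layer to a 1-configuration

  module _ (m : ℕ) (nb : ∀ v → ¬ Large m (Adj v)) (c : ℕ) where
    open ControlBounds m c

    module _ (A : Pd) where
      open Layers A

      back : ∀ {v₀ R} i {v} → (∀ {x} → Ball v₀ i x → R x) → Ball v₀ i v → Walk R v v₀
      back zero    s refl = end (s refl)
      back (suc i) s (inj₁ b) = back i (λ b → s (inj₁ b)) b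
      back (suc i) s b@(inj₂ (_ , u , b' , uv)) = step (s b) (symm uv) (back i (λ b → s (inj₁ b)) b')

      two-control : Large (f₀ + f₀) A → ¬ ¬ Conf 1 c A
      two-control l k = layers-small f₀ small l
        where
        small : ∀ v₀ i → A v₀ → ¬ Large f₀ (Layer v₀ i)
        small v₀ zero a l = single-small (pos v₀) (weaken (s≤s z≤n) (grow (λ e → cong pos e) l))
        small v₀ (suc zero) a l = nb v₀ (weaken (≤-trans (m≤m+n m _) (n≤1+n _)) (grow first l))
          where
          first : ∀ {v} → Layer v₀ 1 v → Adj v₀ v
          first (inj₁ e , n) = ⊥-elim (n e)
          first (inj₂ (_ , _ , refl , uv) , n) = uv
        small v₀ (suc (suc d)) a l =
          halve f₁ (λ w → lt w v₀) (weaken (≤-trans (m≤n+m _ m) (n≤1+n _)) l) λ (σ , l₁) →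
          short-small c₂ (λ v → Layer v₀ (2 + d) v × lt v v₀ ≡ σ)
            (λ u v lu lv uv l₂ → dense σ lu lv uv
               (drop m (Adj v) (nb v) (drop m (Adj u) (nb u) l₂))) l₁
          where
          Par : Pd
          Par = Layer v₀ (suc d)
          out : ∀ {x y} → Layer v₀ (2 + d) y → Ball v₀ d x → ¬ Adj y x
          out {x} (b , n) bx yx = n (inj₂ (ball⊆A (2 + d) a b , x , bx , symm yx))
          conf : ∀ {σ u} {W : Pd} → Layer v₀ (2 + d) u × lt u v₀ ≡ σ → W ⊆ Layer v₀ (2 + d) → (∀ {w} → W w → ¬ Adj u w) →
                 ¬ Large (quad c) (λ w → W w × Cov (λ x → Par x × Adj x u) w)
          conf {u = u} (lu , _) s nu l' = one-side c u l' λ (W' , s' , lW , os) → k (record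
            { K = u ∷ [] ; len = refl ; clq = [] ∷ [] ; K⊆A = ball⊆A (2 + d) a (proj₁ lu) ∷ []
            ; Q = λ x → Par x × Adj x u ; W = W'
            ; Q⊆A = λ (x , _) → ball⊆A (suc d) a (proj₁ x)
            ; W⊆A = λ w → ball⊆A (2 + d) a (proj₁ (s (proj₁ (s' w))))
            ; QK = λ (_ , xu) → xu ∷ [] ; cov = λ w k' → k' (proj₂ (s' w))
            ; anti = λ w → nu (proj₁ (s' w)) ∷ [] ; sides = os ∷ [] ; large = lW })
          Inner : Bool → V → V → Pd
          Inner σ u v t = (((Layer v₀ (2 + d) t × lt t v₀ ≡ σ) × Between u v t) × ¬ Adj u t) × ¬ Adj v t
          -- `u` and `v` are on the same side of `v₀`, so `uv` separates `t` from `v₀`. The walk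
          -- from `t` to `v₀` can be touched only at the parent of `t`, so parents adjacent to `u`
          -- or to `v` cover everything.
          dense : ∀ σ {u v} → Layer v₀ (2 + d) u × lt u v₀ ≡ σ → Layer v₀ (2 + d) v × lt v v₀ ≡ σ → Adj u v →
                  ¬ Large (quad c + quad c) (Inner σ u v)
          dense σ {u} {v} lu lv uv l₃ =
            conf {σ} {v} {S} lv (λ w → proj₁ (proj₁ (proj₁ (proj₁ w)))) proj₂
              (cut (quad c) _ l₃ (λ {t} → cover {t})
                (conf {σ} {u} {S} lu (λ w → proj₁ (proj₁ (proj₁ (proj₁ w)))) (λ w → proj₂ (proj₁ w))))
            where
            S : Pd
            S = Inner σ u v
            cover : ∀ {t} → S t → ¬ ¬ ((S t × Cov (λ x → Par x × Adj x u) t) ⊎ (S t × Cov (λ x → Par x × Adj x v) t))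
            cover (((((inj₁ b , n) , _) , _) , _) , _) _ = n b
            cover {t} st@((((((inj₂ (At , x , bx , xt)) , n) , e) , (ut , tv)) , nu) , nv) k' =
              sep-clash sep (sep-right (xfree uv (symm xt) nu (λ ux → k' (inj₁ (st , x , (px , symm ux) , xt)))
                  nv (λ vx → k' (inj₂ (st , x , (px , symm vx) , xt))))
                (walk bx))
              where
              px : Par x
              px = bx , λ b → n (inj₂ (At , x , b , xt))
              sep : Sep u v t v₀ ≡ true
              sep = trans (xor-swap (lt u t) (lt u v₀) (lt v t) (lt v v₀))
                (trans (cong₂ _xor_ (cong₂ _xor_ (lt-true ut) (lt-false (<⇒≤ tv)))
                  (trans (cong₂ _xor_ (proj₂ lu) (proj₂ lv)) (xor-same σ))) refl)
              walk : Ball v₀ (suc d) x → Sep u v x v₀ ≡ false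
              walk (inj₁ b) = ⊥-elim (proj₂ px b)
              walk (inj₂ (_ , y , by , yx)) = sep-right
                (xfree uv (symm yx) (λ ux → k' (inj₁ (st , x , (px , symm ux) , xt))) (out (proj₁ lu) by)
                  (λ vx → k' (inj₂ (st , x , (px , symm vx) , xt))) (out (proj₁ lv) by))
                (edge-walk uv (back d (λ b → b) by) (λ b → out (proj₁ lu) b , out (proj₁ lv) b))

-- From r-configurations to (r+1)-configurations

AllPairs-resp-⊆ : ∀ {X : Set ℓ₁} {R : X → X → Set ℓ₂} {xs ys : List X} → xs Sub.⊆ ys → AllPairs R ys → AllPairs R xs
AllPairs-resp-⊆ Sub.[]         []       = []
AllPairs-resp-⊆ (_ Sub.∷ʳ s)   (_ ∷ rs) = AllPairs-resp-⊆ s rs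
AllPairs-resp-⊆ (refl Sub.∷ s) (r ∷ rs) = All-resp-⊆ s r ∷ AllPairs-resp-⊆ s rs

-- Either `g` elements carry the first label, or the rest is long enough for the other labels. The
-- answer is a sublist so that pairwise relations survive.
pigeonhole : ∀ {X : Set ℓ₁} {Y : Set ℓ₂} (P : X → Y → Set ℓ₃) g (ys : List Y) (xs : List X) →
             All (λ x → Any (P x) ys) xs → length ys * g < length xs →
             ∃ λ y → y ∈ ys × Σ (List X) λ zs → zs Sub.⊆ xs × g ≤ length zs × All (λ x → P x y) zs
pigeonhole P g [] (x ∷ xs) (() ∷ _) lt
pigeonhole {X = X} P g (y ∷ ys) xs lab lt = go (split xs lab)
  where
  split : ∀ xs → All (λ x → Any (P x) (y ∷ ys)) xs →
          Σ (List X) λ zs → Σ (List X) λ rs → zs Sub.⊆ xs × rs Sub.⊆ xs × length xs ≡ length zs + length rs ×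
            All (λ x → P x y) zs × All (λ x → Any (P x) ys) rs
  split [] [] = [] , [] , Sub.[] , Sub.[] , refl , [] , []
  split (x ∷ xs) (here px ∷ as) =
    let (zs , rs , s , s' , e , z , r) = split xs as
    in x ∷ zs , rs , refl Sub.∷ s , x Sub.∷ʳ s' , cong suc e , px ∷ z , r
  split (x ∷ xs) (there i ∷ as) =
    let (zs , rs , s , s' , e , z , r) = split xs as
    in zs , x ∷ rs , x Sub.∷ʳ s , refl Sub.∷ s' , trans (cong suc e) (sym (+-suc _ _)) , z , i ∷ r
  go : (Σ (List X) λ zs → Σ (List X) λ rs → zs Sub.⊆ xs × rs Sub.⊆ xs × length xs ≡ length zs + length rs ×
            All (λ x → P x y) zs × All (λ x → Any (P x) ys) rs) →
       ∃ λ y' → y' ∈ y ∷ ys × Σ (List X) λ zs → zs Sub.⊆ xs × g ≤ length zs × All (λ x → P x y') zs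
  go (zs , rs , s , s' , e , z , r) with g ≤? length zs
  ... | yes le = y , here refl , zs , s , le , z
  ... | no ¬le =
    let (y' , y∈ , ws , t , le , w) = pigeonhole P g ys rs r
          (+-cancelˡ-< g _ _ (≤-trans (subst (g + length ys * g <_) e lt) (+-monoˡ-≤ (length rs) (<⇒≤ (≰⇒> ¬le)))))
    in y' , there y∈ , ws , Sub.⊆-trans t s' , le , w

¬all⇒¬¬any¬ : ∀ {X : Set ℓ₁} {P : X → Set ℓ₂} (xs : List X) → ¬ All P xs → ¬ ¬ Any (λ x → ¬ P x) xs
¬all⇒¬¬any¬ [] n k = n []
¬all⇒¬¬any¬ {P = P} (x ∷ xs) n k = em (P x) λ where
  (inj₁ px) → ¬all⇒¬¬any¬ xs (λ pxs → n (px ∷ pxs)) λ i → k (there i)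
  (inj₂ np) → k (here np)

module Bounds (m r' c : ℕ) (φ : ℕ → ℕ) where
  -- A set that is Large κ contains an (r+1)-clique.
  r κ e₁ nJ : ℕ
  r = suc r'
  κ = φ 0
  e₁ = m + (m + c)
  nJ = suc r * e₁ + c

  -- Thin pairs (with thinness e) do not cover sets that are Large (NA e).
  hA NA : ℕ → ℕ
  hA e = κ + (suc r * (m + (m + e)) + c)
  NA e = 2 * suc (hA e)

  -- β: size of each of the 13 blocks; s: size of the domain demanded of the vertices of the innermost configuration.
  dA NI β s c₃ : ℕ
  dA = m + (c + quad (NA c))
  NI = NA dA
  β = κ + (κ + (κ + (κ + nJ)))
  s = κ + (κ + (c + (m + (m + (m + (m + (r * m + 0)))))))
  c₃ = r * NI + 13 * suc β

  -- The inner terms pay for a configuration among vertices of small domain and for one among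
  -- vertices of large domain; the outer `ψ` pays for the configuration around both.
  M : (ℕ → ℕ) → ℕ
  M ψ = ψ (ψ (NI + s) + ψ c₃)

  -- Threshold for a configuration that evades `n` given covers.
  F : ℕ → ℕ → ℕ
  F zero    d = φ d
  F (suc n) d = M (λ d' → F n (d + d'))

  pw : ℕ → ℕ → ℕ
  pw zero    n = n
  pw (suc l) n = r * pw l n

  -- Threshold for `n` pairwise related fans over a set that is `Large d`.
  Bd : ℕ → ℕ → ℕ
  Bd zero    d = d
  Bd (suc n) d = Bd n (F n (pw n d))

  q₂ : ℕ
  q₂ = suc r + suc r

  -- Number of fans needed to pick t more vertices: one is used up, the others are shared out
  -- among the q₂ vertices of two (r+1)-cliques.
  g : ℕ → ℕ
  g zero    = 1
  g (suc t) = suc (suc (q₂ * g t))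

  pw' : ℕ → ℕ → ℕ
  pw' zero    n = n
  pw' (suc l) n = c + suc r * pw' l n

  z : ℕ → ℕ
  z zero    = c
  z (suc t) = 3 * suc (κ + pw' (suc (q₂ * g t)) (m + (m + z t)))

  Z : ℕ
  Z = Bd (g (suc r)) (z (suc r))

module Step (G : XGraph) (m r' c : ℕ) (φ : ℕ → ℕ) (nb : Graph.Sparse G m)
  (unav : Graph.Unavoidable G (suc r') φ) (T : Graph.NoFan G (suc (suc r')) c) where
  open XGraph G
  open Graph G

  open Bounds m r' c φ

  -- Cliques that kill covers

  clique : ∀ {A} → Large κ A → ¬ ¬ (Σ (List V) λ C → length C ≡ suc r × AllPairs Adj C × All A C)
  clique {A} l k = unav 0 A l with-parent
    where
    with-parent : ¬ Conf r 0 A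
    with-parent cf = inhabited large λ (w , ww) → cov ww λ (x , qx , _) →
        k (x ∷ K , cong suc len , QK qx ∷ clq , Q⊆A qx ∷ K⊆A)
      where
      open Conf cf

  kill-stable : ∀ {Q h w} → ¬ ¬ Kill Q h w → Kill Q h w
  kill-stable nn x q xw = stable λ n → nn λ k → n (k x q xw)

  -- A vertex of `Q` adjacent to `q` and to some `t` in `R` is adjacent to all killers, hence
  -- complete to `q ∷ K'`, and `NoFan` applies.
  ext-small : ∀ {K' q} {Q R : Pd} → length K' ≡ r → AllPairs Adj K' → All (Adj q) K' →
              (∀ {t} → R t → All (λ h → Kill Q h t) K') → ¬ Large c (λ t → R t × Cov (λ x → Q x × Adj x q) t)
  ext-small {K'} {q} {Q} {R} len clq qK kl =
    T (q ∷ K') (λ x → Q x × Adj x q × All (Adj x) K') _ (cong suc len) (qK ∷ clq) (λ (_ , xq , a) → xq ∷ a)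
      λ (rt , x , (qx , xq) , xt) k → k (x , (qx , xq , All.map (λ kl → kl x qx xt) (kl rt)) , xt)

  -- Off the exceptional sets all of `C` kills `P`, so the neighbours in `P` are complete to `C`.
  kill-clique : ∀ e {C} {P W : Pd} → length C ≡ suc r → AllPairs Adj C → (∀ {w} → W w → ¬ ¬ Cov P w) →
                All (λ y → ¬ Large e (λ w → W w × ¬ Kill P y w)) C → ¬ Large (suc r * e + c) W
  kill-clique e {C} {P} {W} len clq cov sm l =
    T C (λ x → P x × All (Adj x) C) (λ w → W w × All (λ y → ¬ (W w × ¬ Kill P y w)) C) len clq proj₂
      (λ {w} (ww , a) k → cov ww λ (x , px , xw) →
         k (x , (px , All.map (λ {y} n → kill-stable {P} {y} (λ nk → n (ww , nk)) x px xw) a) , xw))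
      (drop-all (λ y w → W w × ¬ Kill P y w) C sm (resize (cong (λ n → n * e + c) (sym len)) l))

  -- y jumps over R: all of R lies between y and a neighbour q of y complete to K'.  Then the edge yq
  -- separates R from a, so y kills on R any cover anchored at a that q hardly meets.
  Jump : Pd → V → List V → V → Set
  Jump R a K' y = ∃ λ q → All (Adj q) K' × Adj y q × ¬ Adj a y × ¬ Adj a q × lt y a ≡ lt q a ×
                    (∀ t → R t → lt y t xor lt q t ≡ true)

  -- `ext-small` bounds the part of `R` reached through neighbours of `q`, so each jumper kills `Q`
  -- on nearly all of `R`.
  jump-clique : ∀ {a} {Q R : Pd} {K' C} → (∀ {x} → Q x → Adj x a) → (∀ {t} → R t → ¬ ¬ Cov Q t) →
                length K' ≡ r → AllPairs Adj K' → (∀ {t} → R t → All (λ h → Kill Q h t) K') →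
                length C ≡ suc r → AllPairs Adj C → All (Jump R a K') C → ¬ Large nJ R
  jump-clique {a} {Q} {R} {K'} {C} Qa cov lenK clqK kl lenC clqC jumps =
    kill-clique e₁ lenC clqC cov (All.map exc jumps)
    where
    exc : ∀ {y} → Jump R a K' y → ¬ Large e₁ (λ t → R t × ¬ Kill Q y t)
    exc {y} (q , qK , yq , ay , aq , side , btw) =
      small-∪ (Adj y) (λ t → Adj q t ⊎ (R t × Cov (λ x → Q x × Adj x q) t))
        (λ {t} (rt , nk) k → nk λ x qx xt → stable λ nxy →
          sep-clash (sep t rt) (edge-path yq (symm xt) (Qa qx)
            (λ yt → k (inj₁ yt)) (λ yx → nxy (symm yx)) (λ ya → ay (symm ya))
            (λ qt → k (inj₂ (inj₁ qt))) (λ qx' → k (inj₂ (inj₂ (rt , x , (qx , symm qx') , xt)))) (λ qa → aq (symm qa))))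
        (nb y) (small-∪ (Adj q) _ (λ s k → k s) (nb q) (ext-small lenK clqK qK kl))
      where
      sep : ∀ t → R t → Sep y q t a ≡ true
      sep t rt = trans (xor-swap (lt y t) (lt y a) (lt q t) (lt q a))
                   (cong₂ _xor_ (btw t rt) (trans (cong (_xor lt q a) side) (xor-same (lt q a))))

  -- The covers Q and P are anchored at a and b.
  module Pair (e : ℕ) {a b : V} {Q P : Pd} (Qa : ∀ {x} → Q x → Adj x a) (Pb : ∀ {p} → P p → Adj p b)
    (¬ab : ¬ Adj a b) (aP : ∀ {p} → P p → ¬ Adj a p) (bQ : ∀ {x} → Q x → ¬ Adj b x) where

    -- For `y` in an (r+1)-clique of `S₁`, the paths `y x a` and `w p b` cross. Sparsity and `thin`
    -- make all contacts but `y p` rare, so `y` kills `P` almost everywhere.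
    half : ∀ {S₁ S₂ : Pd} → (∀ {w} → S₂ w → ¬ Adj a w) → (∀ {w} → S₁ w → ¬ Adj b w) →
           (∀ {w} → S₁ w → ¬ ¬ Cov Q w) → (∀ {w} → S₂ w → ¬ ¬ Cov P w) →
           (∀ {x} → Q x → ¬ Large e (λ w → S₂ w × Cov (λ p → P p × Adj p x) w)) →
           (∀ {y y'} → S₁ y → S₂ y' → Sep y a y' b ≡ true) →
           Large κ S₁ → ¬ Large (suc r * (m + (m + e)) + c) S₂
    half {S₁} {S₂} aS bS covQ covP thin sep l₁ l₂ = clique l₁ λ (C , len , clq , C⊆) →
      all-¬¬ (All.map exc C⊆) λ sm → kill-clique (m + (m + e)) len clq covP sm l₂
      where
      all-¬¬ : ∀ {C} {X : V → Set} → All (λ y → ¬ ¬ X y) C → ¬ ¬ All X C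
      all-¬¬ [] k = k []
      all-¬¬ (x ∷ xs) k = x λ x' → all-¬¬ xs λ xs' → k (x' ∷ xs')
      exc : ∀ {y} → S₁ y → ¬ ¬ ¬ Large (m + (m + e)) (λ w → S₂ w × ¬ Kill P y w)
      exc {y} sy k = covQ sy λ (x , qx , xy) → k (small-∪ (Adj y) (λ w → Adj x w ⊎ (S₂ w × Cov (λ p → P p × Adj p x) w))
          (λ {w} (sw , nk) k' → nk λ p pp pw → stable λ npy →
            sep-clash (sep sy sw) (sep-left
              (edge-path (symm xy) (symm pw) (Pb pp) (λ yw → k' (inj₁ yw)) (λ yp → npy (symm yp)) (λ yb → bS sy (symm yb))
                (λ xw → k' (inj₂ (inj₁ xw))) (λ xp → k' (inj₂ (inj₂ (sw , p , (pp , symm xp) , pw)))) (λ xb → bQ qx (symm xb)))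
              (edge-path (Qa qx) (symm pw) (Pb pp)
                (λ xw → k' (inj₂ (inj₁ xw))) (λ xp → k' (inj₂ (inj₂ (sw , p , (pp , symm xp) , pw)))) (λ xb → bQ qx (symm xb))
                (aS sw) (aP pp) ¬ab)))
          (nb y) (small-∪ (Adj x) _ (λ s k' → k' s) (nb x) (thin qx)))

    -- The parity is the order of `y` and `y'` up to a constant, which decides which of two blocks
    -- plays `S₁`.
    thin-pair : ∀ {A : Pd} → (∀ {w} → A w → ¬ Adj a w) → (∀ {w} → A w → ¬ Adj b w) →
                (∀ {w} → A w → ¬ ¬ Cov Q w) → (∀ {w} → A w → ¬ ¬ Cov P w) → OneSide A a → OneSide A b →
                (∀ {x} → Q x → ¬ Large e (λ w → A w × Cov (λ p → P p × Adj p x) w)) → ¬ Large (NA e) A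
    thin-pair {A} aA bA covQ covP (σ , τ , oa) (σ' , τ' , ob) thin l =
      blocks 2 (hA e) 0 (λ _ → z≤n) l λ (p , _ , mono , bl) →
      let B₀ = Block A (p 0) (p 1) ; B₁ = Block A (p 1) (p 2)
          l₀ = bl 0 (s≤s z≤n) ; l₁ = bl 1 (s≤s (s≤s z≤n))
          big : ∀ {S} → Large (hA e) S → Large κ S
          big = weaken (m≤m+n κ _)
          big' : ∀ {S} → Large (hA e) S → Large (suc r * (m + (m + e)) + c) S
          big' = weaken (m≤n+m _ κ)
      in go (σ' xor (τ xor lt a b)) refl
           (λ eq → half {B₀} {B₁} (λ s → aA (proj₁ s)) (λ s → bA (proj₁ s)) (λ s → covQ (proj₁ s)) (λ s → covP (proj₁ s))
             (λ qx l' → thin qx (grow (λ ((x , _) , y) → x , y) l'))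
             (λ {y} {y'} (sy , _ , lo) (sy' , hi , _) →
               trans (sep y y' (proj₁ (ob sy)) (proj₂ (oa sy'))) (cong₂ _xor_ (lt-true (≤-trans lo hi)) eq))
             (big l₀) (big' l₁))
           (λ eq → half {B₁} {B₀} (λ s → aA (proj₁ s)) (λ s → bA (proj₁ s)) (λ s → covQ (proj₁ s)) (λ s → covP (proj₁ s))
             (λ qx l' → thin qx (grow (λ ((x , _) , y) → x , y) l'))
             (λ {y} {y'} (sy , hi , _) (sy' , _ , lo) →
               trans (sep y y' (proj₁ (ob sy)) (proj₂ (oa sy'))) (cong₂ _xor_ (lt-false (<⇒≤ (≤-trans lo hi))) eq))
             (big l₁) (big' l₀))
      where
      sep : ∀ y y' → lt y b ≡ σ' → lt a y' ≡ τ → Sep y a y' b ≡ lt y y' xor (σ' xor (τ xor lt a b))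
      sep y y' e₁ e₂ = trans (cong₂ _xor_ (cong (lt y y' xor_) e₁) (cong (_xor lt a b) e₂))
                             (xor-assoc (lt y y') σ' (τ xor lt a b))
      go : ∀ β → σ' xor (τ xor lt a b) ≡ β → (σ' xor (τ xor lt a b) ≡ false → ⊥) → (σ' xor (τ xor lt a b) ≡ true → ⊥) → ⊥
      go false eq f g = f eq
      go true  eq f g = g eq

  -- Nested configurations killing a cover

  record Cover (A : Pd) : Set₁ where
    field
      K     : List V
      len   : length K ≡ r
      clq   : AllPairs Adj K
      Q     : Pd
      QK    : ∀ {x} → Q x → All (Adj x) K
      cov   : ∀ {w} → A w → ¬ ¬ Cov Q w
      anti  : ∀ {w} → A w → All (λ h → ¬ Adj h w) K
      sides : All (OneSide A) K

  first : ∀ {n} (K : List V) → length K ≡ suc n → Σ V (_∈ K)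
  first (a ∷ K) _ = a , here refl

  FullKill : ∀ {c' A} → Pd → Conf r c' A → V → Set
  FullKill Q cf w = All (λ h → Kill Q h w) (Conf.K cf)

  -- If both configurations kill the outer cover E, every vertex of the inner clique kills the cover of the outer one.
  no-indep : ∀ {A₀ c₁ c₂ A} (E : Cover A₀) (C₁ : Conf r c₁ A₀) → (∀ {w} → Conf.W C₁ w → FullKill (Cover.Q E) C₁ w) →
             A ⊆ Conf.W C₁ → (C₂ : Conf r c₂ A) → (∀ {w} → Conf.W C₂ w → FullKill (Cover.Q E) C₂ w) →
             ∀ {h} → h ∈ Conf.K C₂ → ¬ Large NI (λ w → Conf.W C₂ w × ¬ Kill (Conf.Q C₁) h w)
  no-indep {A₀} E C₁ k₁ A⊆ C₂ k₂ {h} h∈ =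
    -- Where `h` does not kill, some neighbour in `C₁.Q` is not adjacent to `h`; these neighbours
    -- form a cover that the anchor `h` misses.
    Pair.thin-pair dA {a} {h} {λ x → C₁.Q x × ¬ Adj x h} {C₂.Q}
      (λ (q , _) → All.lookup (C₁.QK q) a∈) (λ p → All.lookup (C₂.QK p) h∈)
      (aanti (A⊆ (All.lookup C₂.K⊆A h∈))) (λ p → aanti (A⊆ (C₂.Q⊆A p))) (λ (_ , n) hx → n (symm hx))
      (λ (w , _) → aanti (A⊆ (C₂.W⊆A w))) (λ (w , _) → All.lookup (C₂.anti w) h∈)
      (λ {w} (ww , nk) k → nk λ x q xw → stable λ n → k (x , (q , n) , xw))
      (λ (w , _) → C₂.cov w)
      (side-⊆ (λ (w , _) → A⊆ (C₂.W⊆A w)) (All.lookup C₁.sides a∈))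
      (side-⊆ proj₁ (All.lookup C₂.sides h∈))
      thin
    where
    module E = Cover E
    module C₁ = Conf C₁
    module C₂ = Conf C₂
    a₀ = proj₁ (first E.K E.len)
    a₀∈ = proj₂ (first E.K E.len)
    a = proj₁ (first C₁.K C₁.len)
    a∈ = proj₂ (first C₁.K C₁.len)
    aanti : ∀ {w} → C₁.W w → ¬ Adj a w
    aanti w = All.lookup (C₁.anti w) a∈
    a₀anti : ∀ {w} → A₀ w → ¬ Adj a₀ w
    a₀anti w = All.lookup (E.anti w) a₀∈
    W* : Pd
    W* w = C₂.W w × ¬ Kill C₁.Q h w
    -- A vertex x of Q₁ dominating much of W* through Q₂ would give a thin pair with the outer cover.
    thin : ∀ {x} → C₁.Q x × ¬ Adj x h → ¬ Large dA (λ w → W* w × Cov (λ p → C₂.Q p × Adj p x) w)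
    thin {x} (qx , _) l =
      one-side (NA c) x
        (drop c (λ w → C₁.W w × Cov (λ z → E.Q z × Adj z x) w) (ext-small C₁.len C₁.clq (C₁.QK qx) k₁)
          (drop m (Adj x) (nb x) l))
      λ (W' , s , l' , os) →
      let w₂ : ∀ {w} → W' w → C₂.W w
          w₂ w = proj₁ (proj₁ (proj₁ (proj₁ (s w))))
          w₁ : ∀ {w} → W' w → C₁.W w
          w₁ w = A⊆ (C₂.W⊆A (w₂ w))
      in Pair.thin-pair c {a₀} {x} {λ z → E.Q z × ¬ Adj z x × ∃ λ w → C₂.W w × Adj z w} {λ p → C₂.Q p × Adj p x}
        (λ (z , _) → All.lookup (E.QK z) a₀∈) proj₂
        (a₀anti (C₁.Q⊆A qx)) (λ (p , _) → a₀anti (C₁.W⊆A (A⊆ (C₂.Q⊆A p)))) (λ (_ , n , _) xz → n (symm xz))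
        (λ w → a₀anti (C₁.W⊆A (w₁ w))) (λ w → proj₂ (proj₁ (s w)))
        (λ {w} ww k → E.cov (C₁.W⊆A (w₁ ww)) λ (z , qz , zw) →
           k (z , (qz , (λ zx → proj₂ (s ww) (w₁ ww , z , (qz , zx) , zw)) , w , w₂ ww , zw) , zw))
        (λ w k → k (proj₂ (proj₁ (proj₁ (s w)))))
        (side-⊆ (λ w → C₁.W⊆A (w₁ w)) (All.lookup E.sides a₀∈)) os
        -- `C₂` kills the outer cover at `w`, so `z` is complete to `C₂.K`, and `NoFan` applies to
        -- this (r+1)-clique.
        (λ {z} (qz , _ , w , ww , zw) l'' →
           T (z ∷ C₂.K) (λ p → C₂.Q p × Adj p z) _ (cong suc C₂.len)
             (All.map (λ kl → kl z qz zw) (k₂ ww) ∷ C₂.clq)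
             (λ (p , pz) → pz ∷ C₂.QK p)
             (λ (_ , p , ((qp , _) , pz) , pw) k → k (p , (qp , pz) , pw)) l'')
        l'

  -- Positions around the innermost configuration

  module Local {A₀ : Pd} {c₁ : ℕ} (E : Cover A₀) (C₁ : Conf r c₁ A₀)
    (k₁ : ∀ {w} → Conf.W C₁ w → FullKill (Cover.Q E) C₁ w)
    {K : List V} (len : length K ≡ r) (clq : AllPairs Adj K) (K⊆ : All (Conf.W C₁) K)
    {Q' W : Pd} (Q'⊆ : Q' ⊆ Conf.W C₁) (W⊆ : W ⊆ Conf.W C₁) (Q'K : ∀ {q} → Q' q → All (Adj q) K)
    (cov' : ∀ {w} → W w → ¬ ¬ Cov Q' w) (sides : All (OneSide W) K)
    (kill : ∀ {w} → W w → All (λ h → Kill (Conf.Q C₁) h w) K)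
    (dom : ∀ {q} → Q' q → Large s (λ t → Conf.W C₁ t × Cov (λ x → Conf.Q C₁ x × Adj x q) t))
    where
    module E = Cover E
    module C₁ = Conf C₁
    a₀ = proj₁ (first E.K E.len)
    a₀∈ = proj₂ (first E.K E.len)
    a₁ = proj₁ (first C₁.K C₁.len)
    a₁∈ = proj₂ (first C₁.K C₁.len)

    Q₁ A₁ : Pd
    Q₁ = C₁.Q
    A₁ = C₁.W

    a₀anti : ∀ {w} → A₀ w → ¬ Adj a₀ w
    a₀anti w = All.lookup (E.anti w) a₀∈
    a₁anti : ∀ {w} → A₁ w → ¬ Adj a₁ w
    a₁anti w = All.lookup (C₁.anti w) a₁∈

    same₀ : ∀ {u v} → A₀ u → A₀ v → lt u a₀ ≡ lt v a₀
    same₀ u v = let (_ , _ , o) = All.lookup E.sides a₀∈ in trans (proj₁ (o u)) (sym (proj₁ (o v)))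
    same₁ : ∀ {u v} → A₁ u → A₁ v → lt u a₁ ≡ lt v a₁
    same₁ u v = let (_ , _ , o) = All.lookup C₁.sides a₁∈ in trans (proj₁ (o u)) (sym (proj₁ (o v)))

    Over : Pd → V → V → Set
    Over R y x = ∀ t → R t → lt y t xor lt x t ≡ true

    -- Jumps through `Q₁` are tested on the outer cover, anchored at `a₀` and killed by `C₁.K`.
    over₁ : ∀ {R : Pd} {C} → R ⊆ A₁ → length C ≡ suc r → AllPairs Adj C →
            All (λ y → A₁ y × ∃ λ x → Q₁ x × Adj x y × Over R y x) C → ¬ Large nJ R
    over₁ {R} R⊆ lenC clqC js = jump-clique {a₀} {E.Q} {R} {C₁.K} (λ q → All.lookup (E.QK q) a₀∈)
      (λ t → E.cov (C₁.W⊆A (R⊆ t))) C₁.len C₁.clq (λ t → k₁ (R⊆ t)) lenC clqC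
      (All.map (λ (y , x , qx , xy , ov) → x , C₁.QK qx , symm xy , a₀anti (C₁.W⊆A y) , a₀anti (C₁.Q⊆A qx) ,
        same₀ (C₁.W⊆A y) (C₁.Q⊆A qx) , ov) js)

    -- One level down: jumps through `Q'` are tested on `Q₁`, anchored at `a₁` and killed by `K`.
    over' : ∀ {R : Pd} {C} → R ⊆ W → length C ≡ suc r → AllPairs Adj C →
            All (λ y → A₁ y × ∃ λ q → Q' q × Adj q y × Over R y q) C → ¬ Large nJ R
    over' {R} R⊆ lenC clqC js = jump-clique {a₁} {Q₁} {R} {K} (λ q → All.lookup (C₁.QK q) a₁∈)
      (λ t → C₁.cov (W⊆ (R⊆ t))) len clq (λ t → kill (R⊆ t)) lenC clqC
      (All.map (λ (y , q , q' , qy , ov) → q , Q'K q' , symm qy , a₁anti y , a₁anti (Q'⊆ q') ,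
        same₁ y (Q'⊆ q') , ov) js)

    over-small₁ : ∀ {R : Pd} → R ⊆ A₁ → Large nJ R → ¬ Large κ (λ y → A₁ y × ∃ λ x → Q₁ x × Adj x y × Over R y x)
    over-small₁ R⊆ lR l = clique l λ (C , lenC , clqC , js) → over₁ R⊆ lenC clqC js lR

    over-small' : ∀ {R : Pd} → R ⊆ W → Large nJ R → ¬ Large κ (λ y → A₁ y × ∃ λ q → Q' q × Adj q y × Over R y q)
    over-small' R⊆ lR l = clique l λ (C , lenC , clqC , js) → over' R⊆ lenC clqC js lR

    over-right : ∀ {y x} {S : Pd} {p q} → pos y < p → q ≤ pos x → Over (Block S p q) y x
    over-right yp qx t (_ , pt , tq) =
      cong₂ _xor_ (lt-true (≤-trans yp pt)) (lt-false (<⇒≤ (≤-trans tq qx)))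

    over-left : ∀ {y x} {S : Pd} {p q} → q ≤ pos y → pos x < p → Over (Block S p q) y x
    over-left qy xp t (_ , pt , tq) =
      cong₂ _xor_ (lt-false (<⇒≤ (≤-trans tq qy))) (lt-true (≤-trans xp pt))

    module Blocks (p : ℕ → ℕ) (mono : ∀ i → p i ≤ p (suc i))
      (bl : ∀ i → i < 13 → Large β (Block W (p i) (p (suc i)))) where

      B : ℕ → Pd
      B i = Block W (p i) (p (suc i))

      B⊆ : ∀ {i} → B i ⊆ A₁
      B⊆ (w , _) = W⊆ w

      lB : ∀ i → i < 13 → Large nJ (B i)
      lB i i<13 = weaken (≤-trans (m≤n+m nJ κ) (≤-trans (m≤n+m _ κ) (≤-trans (m≤n+m _ κ) (m≤n+m _ κ)))) (bl i i<13)

      Within : ℕ → V → Set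
      Within j x = p j ≤ pos x × pos x < p (3 + j)

      record Loc (j : ℕ) : Set where
        field
          w x q  : V
          wB     : B (suc j) w
          x∈     : Q₁ x
          q∈     : Q' q
          xw     : Adj x w
          qw     : Adj q w
          xloc   : Within j x
          qloc   : Within j q

      -- The jumpers over `B j` or `B (2 + j)`, through `Q₁` or `Q'`, form four small sets; `β` is
      -- chosen so that a vertex of the middle block avoids them.
      loc : ∀ j → 2 + j < 13 → ¬ ¬ Loc j
      loc j lt13 k =
        inhabited
          (drop κ _ (over-small' proj₁ (lB (2 + j) lt13))
          (drop κ _ (over-small' proj₁ (lB j (≤-trans (m≤n+m _ 2) lt13)))
          (drop κ _ (over-small₁ B⊆ (lB (2 + j) lt13))
          (drop κ _ (over-small₁ B⊆ (lB j (≤-trans (m≤n+m _ 2) lt13))) (bl (suc j) (≤-trans (n≤1+n _) lt13))))))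
        λ (w , ((((wB@(ww , lo , hi)) , n₁) , n₂) , n₃) , n₄) →
        C₁.cov (W⊆ ww) λ (x , qx , xw) → cov' ww λ (q , q' , qw) →
        k (record { w = w ; x = x ; q = q ; wB = wB ; x∈ = qx ; q∈ = q' ; xw = xw ; qw = qw
          ; xloc = ≮⇒≥ (λ l → n₁ (W⊆ ww , x , qx , xw , over-left lo l)) ,
                   ≰⇒> (λ l → n₂ (W⊆ ww , x , qx , xw , over-right hi l))
          ; qloc = ≮⇒≥ (λ l → n₃ (W⊆ ww , q , q' , qw , over-left lo l)) ,
                   ≰⇒> (λ l → n₄ (W⊆ ww , q , q' , qw , over-right hi l)) })

      -- If q jumps over the block B (3 + j), then so does the (r+1)-clique q ∷ K: the members of K, adjacent
      -- to the local vertices of Q₁ on both sides of the block, jump by means of these.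
      no-far : ∀ j → 3 + j < 13 → (L : Loc j) (L' : Loc (4 + j)) → ∀ {q x} → Q' q → Q₁ x → Adj x q → ¬ Over (B (3 + j)) q x
      no-far j lt13 L L' {q} {x} q' qx xq ov =
        over₁ {B (3 + j)} B⊆ (cong suc len) (Q'K q' ∷ clq) ((Q'⊆ q' , x , qx , xq , ov) ∷ tab (λ z → z)) (lB (3 + j) lt13)
        where
        module L = Loc L
        module L' = Loc L'
        via : ∀ {h} → h ∈ K → A₁ h × ∃ λ x → Q₁ x × Adj x h × Over (B (3 + j)) h x
        via {h} h∈ = All.lookup K⊆ h∈ , choice (All.lookup sides h∈)
          where
          choice : OneSide W h → ∃ λ x → Q₁ x × Adj x h × Over (B (3 + j)) h x
          choice (_ , true , o)  = L'.x , L'.x∈ , All.lookup (kill (proj₁ L'.wB)) h∈ L'.x L'.x∈ L'.xw ,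
            λ t (tw , pt , tq) → cong₂ _xor_ (proj₂ (o tw)) (lt-false (<⇒≤ (≤-trans tq (proj₁ L'.xloc))))
          choice (_ , false , o) = L.x , L.x∈ , All.lookup (kill (proj₁ L.wB)) h∈ L.x L.x∈ L.xw ,
            λ t (tw , pt , tq) → cong₂ _xor_ (proj₂ (o tw)) (lt-true (≤-trans (proj₂ L.xloc) pt))
        tab : ∀ {K'} → (∀ {h} → h ∈ K' → h ∈ K) → All (λ y → A₁ y × ∃ λ x → Q₁ x × Adj x y × Over (B (3 + j)) y x) K'
        tab {[]}     i = []
        tab {h ∷ K'} i = via (i (here refl)) ∷ tab (λ z → i (there z))

      near-right : ∀ j → 3 + j < 13 → (L : Loc j) → Loc (4 + j) → ∀ {x} → Q₁ x → Adj x (Loc.q L) → pos x < p (4 + j)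
      near-right j lt13 L L' qx xq =
        ≰⇒> λ l → no-far j lt13 L L' (Loc.q∈ L) qx xq (over-right (proj₂ (Loc.qloc L)) l)

      near-left : ∀ j → 3 + j < 13 → Loc j → (L' : Loc (4 + j)) → ∀ {x} → Q₁ x → Adj x (Loc.q L') → p (3 + j) ≤ pos x
      near-left j lt13 L L' qx xq =
        ≮⇒≥ λ l → no-far j lt13 L L' (Loc.q∈ L') qx xq (over-left (proj₁ (Loc.qloc L')) l)

      -- Some t with a common neighbour x ∈ Q₁ of t and q₅, x not adjacent to some h ∈ K, lies in the middle
      -- blocks; the path w₀ q₀ h q₁₀ w₁₀ separates it from a₁ without touching the path t x a₁.
      contra : Loc 0 → Loc 1 → Loc 4 → Loc 5 → Loc 6 → Loc 9 → Loc 10 → ⊥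
      contra L₀ L₁ L₄ L₅ L₆ L₉ L₁₀ =
        inhabited
          (drop-all (λ h → Adj h) K (All.tabulate (λ {h} _ → nb h))
            (resize (cong (λ n → n * m + 0) (sym len))
          (drop m (Adj L₁₀.q) (nb L₁₀.q)
          (drop m (Adj L₁₀.w) (nb L₁₀.w)
          (drop m (Adj L₀.q) (nb L₀.q)
          (drop m (Adj L₀.w) (nb L₀.w)
          (drop c _ complete-small
          (drop κ _ (over-small₁ (B⊆ {3}) (lB 3 (from-yes (4 ≤? 13))))
          (drop κ _ (over-small₁ (B⊆ {9}) (lB 9 (from-yes (10 ≤? 13)))) (dom L₅.q∈))))))))))
        λ (t , ((((((((At , x , (qx , x5) , xt) , n₁) , n₂) , n₃) , n₄) , n₅) , n₆) , n₇) , nK) →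
        -- Nearness to `q₅` puts `x` into blocks 4 to 8; as `t` jumps over neither block 3 nor block
        -- 9, it lies in blocks 3 to 9.
        let lo  = near-left 1 (from-yes (5 ≤? 13)) L₁ L₅ qx x5
            hi  = near-right 5 (from-yes (9 ≤? 13)) L₅ L₉ qx x5
            tlo = ≮⇒≥ λ l → n₂ (At , x , qx , xt , over-right l lo)
            thi = ≰⇒> λ l → n₁ (At , x , qx , xt , over-left l hi)
            (h , h∈ , xh) = find (Allₚ.¬All⇒Any¬ (adj? x) K (λ a → n₃ (At , x , (qx , x5 ∷ a) , xt)))
            ¬w : ∀ {w} → W w → ¬ Adj w x
            -- All of `K` kills `Q₁` on `W`, whereas `x` misses `h`.
            ¬w ww wx = xh (All.lookup (kill ww) h∈ x qx (symm wx))
            ¬a : ∀ {w} → A₁ w → ¬ Adj w a₁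
            ¬a w wa = a₁anti w (symm wa)
            ¬q₀ : ¬ Adj L₀.q x
            ¬q₀ q = <⇒≱ (near-right 0 (from-yes (4 ≤? 13)) L₀ L₄ qx (symm q)) lo
            ¬q₁₀ : ¬ Adj L₁₀.q x
            ¬q₁₀ q = <⇒≱ hi (near-left 6 (from-yes (10 ≤? 13)) L₆ L₁₀ qx (symm q))
            ¬ht : ¬ Adj h t
            ¬ht = All.lookup nK h∈
            ¬hx : ¬ Adj h x
            ¬hx hx = xh (symm hx)
            Ah = All.lookup K⊆ h∈
            xa = All.lookup (C₁.QK qx) a₁∈
            tx = symm xt
            W₀ = proj₁ L₀.wB
            W₁₀ = proj₁ L₁₀.wB
            s₁ = edge-path (symm L₀.qw) tx xa n₄ (¬w W₀) (¬a (W⊆ W₀)) n₅ ¬q₀ (¬a (Q'⊆ L₀.q∈))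
            s₂ = edge-path (All.lookup (Q'K L₀.q∈) h∈) tx xa n₅ ¬q₀ (¬a (Q'⊆ L₀.q∈)) ¬ht ¬hx (¬a Ah)
            s₃ = edge-path (symm (All.lookup (Q'K L₁₀.q∈) h∈)) tx xa ¬ht ¬hx (¬a Ah) n₇ ¬q₁₀ (¬a (Q'⊆ L₁₀.q∈))
            s₄ = edge-path L₁₀.qw tx xa n₇ ¬q₁₀ (¬a (Q'⊆ L₁₀.q∈)) n₆ (¬w W₁₀) (¬a (W⊆ W₁₀))
        in clash (sep-left s₁ (sep-left s₂ (sep-left s₃ s₄)))
             (lt-true (≤-trans (proj₂ (proj₂ L₀.wB)) (≤-trans (mono 2) tlo)))
             (lt-false (<⇒≤ (≤-trans thi (≤-trans (mono 10) (proj₁ (proj₂ L₁₀.wB))))))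
             (same₁ (W⊆ W₀) (W⊆ W₁₀))
        where
        module L₀ = Loc L₀
        module L₅ = Loc L₅
        module L₁₀ = Loc L₁₀
        complete-small : ¬ Large c (λ t → A₁ t × Cov (λ x → Q₁ x × All (Adj x) (L₅.q ∷ K)) t)
        complete-small = T (L₅.q ∷ K) (λ x → Q₁ x × All (Adj x) (L₅.q ∷ K)) _ (cong suc len) (Q'K L₅.q∈ ∷ clq) proj₂
          (λ (_ , cv) k → k cv)
        clash : ∀ {w w' t a} → Sep w w' t a ≡ false → lt w t ≡ true → lt w' t ≡ false → lt w a ≡ lt w' a → ⊥
        clash {w} {w'} {t} {a} sp e e' e'' =
          sep-clash (trans (xor-swap (lt w t) (lt w a) (lt w' t) (lt w' a))
            (cong₂ _xor_ (cong₂ _xor_ e e') (trans (cong (_xor lt w' a) e'') (xor-same (lt w' a))))) sp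

    local-contra : ¬ Large (13 * suc β) W
    local-contra l = blocks 13 β 0 (λ _ → z≤n) l λ (p , _ , mono , bl) → in-blocks p mono bl
      where
      in-blocks : (p : ℕ → ℕ) → (∀ i → p i ≤ p (suc i)) → ¬ (∀ i → i < 13 → Large β (Block W (p i) (p (suc i))))
      in-blocks p mono bl =
        loc 0 (from-yes (3 ≤? 13)) λ L₀ → loc 1 (from-yes (4 ≤? 13)) λ L₁ → loc 4 (from-yes (7 ≤? 13)) λ L₄ →
        loc 5 (from-yes (8 ≤? 13)) λ L₅ → loc 6 (from-yes (9 ≤? 13)) λ L₆ → loc 9 (from-yes (12 ≤? 13)) λ L₉ →
        loc 10 (from-yes (13 ≤? 13)) λ L₁₀ → contra L₀ L₁ L₄ L₅ L₆ L₉ L₁₀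
        where
        open Blocks p mono bl

  KConf : Pd → ℕ → Pd → Set₁
  KConf Q c' A = Σ (Conf r c' A) λ cf → ∀ {w} → Conf.W cf w → FullKill Q cf w

  -- Split `C₁.W` by how much a vertex dominates through `C₁.Q`. A configuration among poor vertices
  -- contradicts `no-indep`, since a killer dominates what it kills; among rich vertices `Local`
  -- applies.
  killed-small : ∀ {A₀} (E : Cover A₀) (ψ : ℕ → ℕ) →
                 (∀ c' A → A ⊆ A₀ → Large (ψ c') A → ¬ ¬ KConf (Cover.Q E) c' A) → ¬ Large (M ψ) A₀
  killed-small {A₀} E ψ U l = U (ψ (NI + s) + ψ c₃) A₀ (λ x → x) l λ (C₁ , k₁) → inside C₁ k₁
    where
    inside : ∀ (C₁ : Conf r (ψ (NI + s) + ψ c₃) A₀) → ¬ (∀ {w} → Conf.W C₁ w → FullKill (Cover.Q E) C₁ w)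
    inside C₁ k₁ = U c₃ (λ v → C₁.W v × A⁰ v) (λ (v , _) → C₁.W⊆A v)
        (cut (ψ (NI + s)) (λ v → C₁.W v × ¬ A⁰ v) C₁.large
          (λ {v} w k → em (A⁰ v) λ where
            (inj₁ a) → k (inj₂ (w , a))
            (inj₂ n) → k (inj₁ (w , n)))
          λ l' → U (NI + s) (λ v → C₁.W v × ¬ A⁰ v) (λ (v , _) → C₁.W⊆A v) l' λ (C₂ , k₂) → poor C₂ k₂)
        λ (C , k) → rich C k
      where
      module C₁ = Conf C₁
      A⁰ : Pd
      A⁰ v = Large s (λ t → C₁.W t × Cov (λ x → C₁.Q x × Adj x v) t)

      poor : ∀ (C₂ : Conf r (NI + s) (λ v → C₁.W v × ¬ A⁰ v)) → ¬ (∀ {w} → Conf.W C₂ w → FullKill (Cover.Q E) C₂ w)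
      poor C₂ k₂ = proj₂ (All.lookup C₂.K⊆A h∈)
          (cut NI (λ w → C₂.W w × ¬ Kill C₁.Q h w) C₂.large
            (λ {w} ww k → C₁.cov (proj₁ (C₂.W⊆A ww)) λ (x , qx , xw) →
              em (Adj x h) λ where
                (inj₁ xh) → k (inj₂ (proj₁ (C₂.W⊆A ww) , x , (qx , xh) , xw))
                (inj₂ n)  → k (inj₁ (ww , λ kl → n (kl x qx xw))))
            (no-indep E C₁ k₁ proj₁ C₂ k₂ h∈))
        where
        module C₂ = Conf C₂
        h = proj₁ (first C₂.K C₂.len)
        h∈ = proj₂ (first C₂.K C₂.len)

      rich : ∀ (C : Conf r c₃ (λ v → C₁.W v × A⁰ v)) → ¬ (∀ {w} → Conf.W C w → FullKill (Cover.Q E) C w)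
      rich C k = Local.local-contra E C₁ k₁ C.len C.clq (All.map proj₁ C.K⊆A)
          {C.Q} {λ w → C.W w × All (λ h → ¬ Alive h w) C.K}
          (λ q → proj₁ (C.Q⊆A q)) (λ (w , _) → proj₁ (C.W⊆A w)) C.QK (λ (w , _) → C.cov w)
          (All.map (side-⊆ proj₁) C.sides)
          (λ (w , a) → All.map (λ {h} n → kill-stable {C₁.Q} {h} λ nk → n (w , nk)) a)
          (λ q → proj₂ (C.Q⊆A q))
          (drop-all Alive C.K (All.tabulate (λ h∈ → no-indep E C₁ k₁ proj₁ C k h∈))
            (subst (λ n → Large (n * NI + 13 * suc β) C.W) (sym C.len) C.large))
        where
        module C = Conf C
        Alive : V → Pd
        Alive h w = C.W w × ¬ Kill C₁.Q h w

  -- Building pairwise related fans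

  record Fan : Set₁ where
    field
      K   : List V
      len : length K ≡ r
      clq : AllPairs Adj K
      Q   : Pd
      QK  : ∀ {x} → Q x → All (Adj x) K

  record Covers (A : Pd) (E : Fan) : Set where
    open Fan E
    field
      cov   : ∀ {w} → A w → ¬ ¬ Cov Q w
      anti  : ∀ {w} → A w → All (λ h → ¬ Adj h w) K
      sides : All (OneSide A) K

  cover : ∀ {A E} → Covers A E → Cover A
  cover {A} {E} cv = record { Fan E ; Covers cv }

  covers-⊆ : ∀ {A A' E} → A' ⊆ A → Covers A E → Covers A' E
  covers-⊆ s cv = record { cov = λ w → cov (s w) ; anti = λ w → anti (s w) ; sides = All.map (side-⊆ s) sides }
    where
    open Covers cv

  fan : ∀ {c' A} → Conf r c' A → Fan
  fan cf = record { K = K ; len = len ; clq = clq ; Q = Q ; QK = QK }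
    where
    open Conf cf

  fan-covers : ∀ {c' A} (cf : Conf r c' A) → Covers (Conf.W cf) (fan cf)
  fan-covers cf = record { cov = cov ; anti = anti ; sides = sides }
    where
    open Conf cf

  shrink : ∀ {c₁ c₂ A} (cf : Conf r c₁ A) (W' : Pd) → W' ⊆ Conf.W cf → Large c₂ W' → Conf r c₂ A
  shrink cf W' s l = record { K = K ; len = len ; clq = clq ; K⊆A = K⊆A ; Q = Q ; W = W' ; Q⊆A = Q⊆A
    ; W⊆A = λ w → W⊆A (s w) ; QK = QK ; cov = λ w → cov (s w) ; anti = λ w → anti (s w)
    ; sides = All.map (side-⊆ s) sides ; large = l }
    where
    open Conf cf

  enlarge : ∀ {c₁ A A'} → A ⊆ A' → Conf r c₁ A → Conf r c₁ A'
  enlarge s cf = record { K = K ; len = len ; clq = clq ; K⊆A = All.map s K⊆A ; Q = Q ; W = W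
    ; Q⊆A = λ q → s (Q⊆A q) ; W⊆A = λ w → s (W⊆A w) ; QK = QK ; cov = cov ; anti = anti
    ; sides = sides ; large = large }
    where
    open Conf cf

  Evades : ∀ {c' A} → Conf r c' A → List Fan → Set₁
  Evades cf Es = ∀ {w} → Conf.W cf w → All (λ E → ¬ FullKill (Fan.Q E) cf w) Es

  -- If `E` survived only on small parts of the configurations evading the other fans, every large
  -- subset would contain one killing `E`, against `killed-small`.
  evading : ∀ Es {A} → All (Covers A) Es → ∀ d → Large (F (length Es) d) A →
            ¬ ¬ (Σ (Conf r d A) λ cf → Evades cf Es)
  evading [] cvs d l k = unav d _ l λ cf → k (cf , λ _ → [])
  evading (E ∷ Es) {A} (cv ∷ cvs) d l k = killed-small (cover cv) (λ d' → F (length Es) (d + d'))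
    (λ d' A' s l' k' → evading Es (All.map (covers-⊆ s) cvs) (d + d') l' λ (cf , ev) → killing d' s k' cf ev)
    l
    where
    killing : ∀ d' {A'} → A' ⊆ A → ¬ KConf (Fan.Q E) d' A' → (cf : Conf r (d + d') A') → ¬ Evades cf Es
    killing d' s k' cf ev =
        k' (shrink cf (λ w → C.W w × ¬ Alive w) proj₁
              (drop d Alive (λ la → k (enlarge s (shrink cf Alive proj₁ la) , λ (w , n) → n ∷ ev w)) C.large) ,
            λ (w , n) → All.tabulate λ {h} h∈ → kill-stable {Fan.Q E} {h} λ nk →
              n (w , λ fk → nk (All.lookup fk h∈)))
      where
      module C = Conf cf
      Alive : Pd
      Alive w = C.W w × ¬ FullKill (Fan.Q E) cf w

  -- N is newer than O; lists of fans are kept newest first.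
  Rel : Fan → Fan → Set
  Rel N O = ∃ λ a → a ∈ Fan.K O × (∀ {x} → Fan.Q N x → ¬ Adj a x) ×
            ∃ λ h → h ∈ Fan.K N × ¬ Adj a h × (∀ {x} → Fan.Q O x → ¬ Adj h x)

  Trim : Fan → Fan → Set
  Trim E E' = Fan.K E' ≡ Fan.K E × (∀ {x} → Fan.Q E' x → Fan.Q E x)

  trim-rel : ∀ {N O N' O'} → Trim N N' → Trim O O' → Rel N O → Rel N' O'
  trim-rel (refl , s) (refl , s') (a , a∈ , aQ , h , h∈ , ah , hQ) =
    a , a∈ , (λ q → aQ (s q)) , h , h∈ , ah , λ q → hQ (s' q)

  trim-all : ∀ {N N' Os Os'} → Trim N N' → Pointwise Trim Os Os' → All (Rel N) Os → All (Rel N') Os'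
  trim-all t [] [] = []
  trim-all {N} {N'} t (_∷_ {O} {O'} t' ts) (x ∷ xs) = trim-rel {N} {O} {N'} {O'} t t' x ∷ trim-all {N} {N'} t ts xs

  trim-pairs : ∀ {Es Es'} → Pointwise Trim Es Es' → AllPairs Rel Es → AllPairs Rel Es'
  trim-pairs [] [] = []
  trim-pairs (_∷_ {E} {E'} t ts) (x ∷ xs) = trim-all {E} {E'} t ts x ∷ trim-pairs ts xs

  trim-length : ∀ {Es Es'} → Pointwise Trim Es Es' → length Es' ≡ length Es
  trim-length [] = refl
  trim-length (_ ∷ ts) = cong suc (trim-length ts)

  -- For each old fan a pigeonhole over `K` finds one `h` that fails to kill it on a large part; the
  -- vertices of the fan not adjacent to `h` still cover that part.
  refine : ∀ {n A W} K → length K ≡ r → ∀ Es → W ⊆ A → All (Covers A) Es →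
           (∀ {w} → W w → All (λ E → ¬ All (λ h → Kill (Fan.Q E) h w) K) Es) → Large (pw (length Es) n) W →
           ¬ ¬ (Σ Pd λ W' → W' ⊆ W × Large n W' × Σ (List Fan) λ Es' → Pointwise Trim Es Es' × All (Covers W') Es' ×
             All (λ E → (∀ {w} → A w → All (λ a → ¬ Adj a w) (Fan.K E)) × ∃ λ h → h ∈ K × (∀ {x} → Fan.Q E x → ¬ Adj h x)) Es')
  refine K len [] s cvs ev l k = k (_ , (λ w → w) , l , [] , [] , [] , [])
  refine {n} {A} {W} K len (E ∷ Es) s (cv ∷ cvs) ev l k =
    pigeon (λ h w → ¬ Kill (Fan.Q E) h w) K (λ w → ¬all⇒¬¬any¬ K (All.head (ev w)))
      (resize (cong (_* pw (length Es) n) (sym len)) l) λ any →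
    let (h , h∈ , l₁) = find any
    in refine {n} {A} K len Es (λ (w , _) → s w) cvs (λ (w , _) → All.tail (ev w)) l₁ λ (W' , s' , l' , Es' , ts , cvs' , hs) →
    let E' : Fan
        E' = record { K = Fan.K E ; len = Fan.len E ; clq = Fan.clq E ; Q = λ x → Fan.Q E x × ¬ Adj x h
                    ; QK = λ (q , _) → Fan.QK E q }
    in k (W' , (λ w → proj₁ (s' w)) , l' , E' ∷ Es' , (refl , proj₁) ∷ ts ,
          record { cov   = λ w k' → proj₂ (s' w) λ x q xw → stable λ nxh → k' (x , (q , nxh) , xw)
                 ; anti  = λ w → Covers.anti cv (s (proj₁ (s' w)))
                 ; sides = All.map (side-⊆ (λ w → s (proj₁ (s' w)))) (Covers.sides cv) } ∷ cvs' ,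
          (Covers.anti cv , h , h∈ , λ (_ , n) hx → n (symm hx)) ∷ hs)

  Tuple : Pd → ℕ → Set₁
  Tuple A n = Σ (List Fan) λ Es → length Es ≡ n × AllPairs Rel Es × All (Covers A) Es

  new-rel : ∀ {c' A} (cf : Conf r c' A) E → (∀ {w} → A w → All (λ a → ¬ Adj a w) (Fan.K E)) →
            ∀ {h} → h ∈ Conf.K cf → (∀ {x} → Fan.Q E x → ¬ Adj h x) → Rel (fan cf) E
  new-rel cf E an {h} h∈ hQ = a , a∈ , (λ q → All.lookup (an (C.Q⊆A q)) a∈) , h , h∈ ,
                              All.lookup (an (All.lookup C.K⊆A h∈)) a∈ , hQ
    where
    module C = Conf cf
    a = proj₁ (first (Fan.K E) (Fan.len E))
    a∈ = proj₂ (first (Fan.K E) (Fan.len E))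

  build : ∀ n d {A} → Large (Bd n d) A → ¬ ¬ (Σ Pd λ A' → Large d A' × Tuple A' n)
  build zero d l k = k (_ , l , [] , refl , [] , [])
  build (suc n) d l k = build n (F n (pw n d)) l λ (A , lA , Es , lenE , ap , cvs) →
    evading Es cvs (pw n d) (subst (λ x → Large (F x (pw n d)) A) (sym lenE) lA) λ (cf , ev) →
    refine {d} {A} (Conf.K cf) (Conf.len cf) Es (Conf.W⊆A cf) cvs ev
      (subst (λ x → Large (pw x d) (Conf.W cf)) (sym lenE) (Conf.large cf))
    λ (W' , s , l' , Es' , ts , cvs' , hs) →
    k (W' , l' , fan cf ∷ Es' , cong suc (trans (trim-length ts) lenE) ,
       All.map (λ {E} (an , h , h∈ , hQ) → new-rel cf E an h∈ hQ) hs ∷ trim-pairs ts ap ,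
       covers-⊆ s (fan-covers cf) ∷ cvs')

  -- Picking a clique from related fans

  Good : Fan → Pd → Fan → V → Set
  Good N W O y = (∀ {w} → W w → ¬ Kill (Fan.Q O) y w) × ∃ λ a → ∃ λ h → a ∈ Fan.K O × h ∈ Fan.K N ×
    (∀ {w} → W w → Sep y h w a ≡ true) ×
    (∀ {x} → Fan.Q N x → ¬ Adj a x) × ¬ Adj a h × (∀ {x} → Fan.Q O x → ¬ Adj h x)

  good-⊆ : ∀ {N W W' O y} → W' ⊆ W → Good N W O y → Good N W' O y
  good-⊆ s (nk , a , h , a∈ , h∈ , sp , rest) = (λ w → nk (s w)) , a , h , a∈ , h∈ , (λ w → sp (s w)) , rest

  module Assign {A : Pd} {N : Fan} (cvN : Covers A N) {p q : ℕ} (C₁ C₂ : List V)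
    (len₁ : length C₁ ≡ suc r) (len₂ : length C₂ ≡ suc r) (clq₁ : AllPairs Adj C₁) (clq₂ : AllPairs Adj C₂)
    (lo : All (λ y → A y × pos y < p) C₁) (hi : All (λ y → A y × q ≤ pos y) C₂) where

    -- Where all of `C` kills `O`, the neighbours in `O` are complete to `C`; `NoFan` makes this
    -- part small.
    survivor : ∀ {C n W} O → Covers A O → W ⊆ A → length C ≡ suc r → AllPairs Adj C → Large (c + suc r * n) W →
               ¬ ¬ (∃ λ y → y ∈ C × Large n (λ w → W w × ¬ Kill (Fan.Q O) y w))
    survivor {C} {n} {W} O cv s len clq l k =
      pigeon (λ y w → ¬ Kill (Fan.Q O) y w) {n} C (λ (w , ne) → ¬all⇒¬¬any¬ C λ a → ne (w , a))
        (subst (λ x → Large (x * n) (λ w → W w × ¬ All-killed w)) (sym len)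
          (drop c All-killed
            (T C (λ x → Fan.Q O x × All (Adj x) C) _ len clq proj₂
              (λ (w , a) k' → Covers.cov cv (s w) λ (x , q , xw) → k' (x , (q , All.map (λ kl → kl x q xw) a) , xw))) l))
        λ any → let (y , y∈ , ly) = find any in k (y , y∈ , grow (λ ((w , _) , nk) → w , nk) ly)
      where
      All-killed : Pd
      All-killed w = W w × All (λ y → Kill (Fan.Q O) y w) C

    -- One-sidedness fixes the parity up to the order of `y` and `w`, so the clique before or the
    -- one after the block has the right parity.
    oriented : ∀ {n W} O → Covers A O → Rel N O → (∀ {w} → W w → Block A p q w) → Large (c + suc r * n) W →
               ¬ ¬ (Σ Pd λ W' → W' ⊆ W × Large n W' × Any (Good N W' O) (C₁ ++ C₂))
    oriented {n} {W} O cv (a , a∈ , aQ , h , h∈ , ah , hQ) blk l k =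
      go (All.lookup (Covers.sides cv) a∈) (All.lookup (Covers.sides cvN) h∈)
      where
      inA : W ⊆ A
      inA w = proj₁ (blk w)
      good : ∀ {y W'} → W' ⊆ (λ w → W w × ¬ Kill (Fan.Q O) y w) → (∀ {w} → W w → Sep y h w a ≡ true) → Good N W' O y
      good s sp = (λ w → proj₂ (s w)) , a , h , a∈ , h∈ , (λ w → sp (proj₁ (s w))) , aQ , ah , hQ
      go : OneSide A a → OneSide A h → ⊥
      go (σ , _ , oa) (_ , τ , oh) = decide (σ xor (τ xor lt h a)) refl
        where
        sep : ∀ {y w} → A y → A w → Sep y h w a ≡ lt y w xor (σ xor (τ xor lt h a))
        sep {y} {w} Ay Aw = trans (cong₂ _xor_ (cong (lt y w xor_) (proj₁ (oa Ay))) (cong (_xor lt h a) (proj₂ (oh Aw))))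
                                  (xor-assoc (lt y w) σ (τ xor lt h a))
        decide : ∀ b → σ xor (τ xor lt h a) ≡ b → ⊥
        decide false e = survivor {C₁} {n} O cv inA len₁ clq₁ l λ (y , y∈ , ly) →
          let (Ay , yp) = All.lookup lo y∈
          in k (_ , proj₁ , ly , Anyₚ.++⁺ˡ (lose y∈ (good (λ w → w) λ w →
               trans (sep Ay (inA w)) (cong₂ _xor_ (lt-true (≤-trans yp (proj₁ (proj₂ (blk w))))) e))))
        decide true e = survivor {C₂} {n} O cv inA len₂ clq₂ l λ (y , y∈ , ly) →
          let (Ay , yq) = All.lookup hi y∈
          in k (_ , proj₁ , ly , Anyₚ.++⁺ʳ C₁ (lose y∈ (good (λ w → w) λ w →
               trans (sep Ay (inA w)) (cong₂ _xor_ (lt-false (<⇒≤ (≤-trans (proj₂ (proj₂ (blk w))) yq))) e))))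

    assign : ∀ Os → All (Covers A) Os → All (Rel N) Os → ∀ {n W} → (∀ {w} → W w → Block A p q w) →
             Large (pw' (length Os) n) W →
             ¬ ¬ (Σ Pd λ W' → W' ⊆ W × Large n W' × All (λ O → Any (Good N W' O) (C₁ ++ C₂)) Os)
    assign [] [] [] blk l k = k (_ , (λ w → w) , l , [])
    assign (O ∷ Os) (cv ∷ cvs) (rl ∷ rls) {n} blk l k =
      oriented {pw' (length Os) n} O cv rl blk l λ (W₁ , s₁ , l₁ , gd) →
      assign Os cvs rls {n} (λ w → blk (s₁ w)) l₁ λ (W₂ , s₂ , l₂ , gds) →
      k (W₂ , (λ w → s₁ (s₂ w)) , l₂ , Any.map (λ {y} → good-⊆ {N} {W₁} {W₂} {O} {y} s₂) gd ∷ gds)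

  trace : V → Fan → Fan
  trace x O = record { K = Fan.K O ; len = Fan.len O ; clq = Fan.clq O ; Q = λ p → Fan.Q O p × Adj p x
                     ; QK = λ (p , _) → Fan.QK O p }

  traces : V → List Fan → List Fan
  traces x [] = []
  traces x (O ∷ Os) = trace x O ∷ traces x Os

  traces-trim : ∀ x Os → Pointwise Trim Os (traces x Os)
  traces-trim x [] = []
  traces-trim x (O ∷ Os) = (refl , proj₁) ∷ traces-trim x Os

  traces-all : ∀ {x Os} {P : Fan → Set} → All (λ O → P (trace x O)) Os → All P (traces x Os)
  traces-all [] = []
  traces-all (p ∷ ps) = p ∷ traces-all ps

  Complete : List V → Fan → Set
  Complete X E = ∀ x → Fan.Q E x → All (Adj x) X

  -- Some neighbour `p` of `w` in `O` is missed by `y`. The paths `y x h` and `w p a` cross with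
  -- every contact but `x p` excluded, so `p` is adjacent to `x`.
  trace-covers : ∀ {A W N O x y} → Covers A N → Covers A O → W ⊆ A → A y → Fan.Q N x → Adj x y →
                 Good N W O y → Covers (λ w → (W w × ¬ Adj y w) × ¬ Adj x w) (trace x O)
  trace-covers {A} {W} {N} {O} {x} {y} cvN cvO s Ay qx xy (nk , a , h , a∈ , h∈ , sp , aQ , ah , hQ) = record
    { cov = λ ((ww , yw) , xw) k → nk ww λ p pq pw → stable λ py →
        k (p , (pq , stable λ px → sep-clash (sp ww) (sep-left
              (edge-path (symm xy) (symm pw) (All.lookup (Fan.QK O pq) a∈) yw (λ e → py (symm e)) (λ e → aA Ay (symm e))
                xw (λ e → px (symm e)) (λ e → aQ qx (symm e)))
              (edge-path (All.lookup (Fan.QK N qx) h∈) (symm pw) (All.lookup (Fan.QK O pq) a∈)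
                xw (λ e → px (symm e)) (λ e → aQ qx (symm e))
                (All.lookup (Covers.anti cvN (s ww)) h∈) (hQ pq) (λ e → ah (symm e))))) , pw)
    ; anti  = λ w → Covers.anti cvO (s (proj₁ (proj₁ w)))
    ; sides = All.map (side-⊆ (λ w → s (proj₁ (proj₁ w)))) (Covers.sides cvO) }
    where
    aA : ∀ {w} → A w → ¬ Adj a w
    aA w = All.lookup (Covers.anti cvO w) a∈

  -- X is the clique built so far, t the number of vertices still to be picked.
  tuple-small : ∀ t {A} X Es → length X + t ≡ suc r → AllPairs Adj X → length Es ≡ g t → AllPairs Rel Es →
                All (Covers A) Es → All (Complete X) Es → ¬ Large (z t) A
  tuple-small zero {A} X (E ∷ []) lenX clqX _ _ (cv ∷ _) (cp ∷ _) =
    T X (Fan.Q E) A (trans (sym (+-identityʳ _)) lenX) clqX (cp _) (Covers.cov cv)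
  tuple-small (suc t) {A} X (N ∷ Os) lenX clqX lenE (rl ∷ rls) (cvN ∷ cvs) (cpN ∷ cps) l =
    blocks 3 (κ + _) 0 (λ _ → z≤n) l λ (p , _ , mono , bl) →
    clique (weaken (m≤m+n κ _) (bl 0 (from-yes (1 ≤? 3)))) λ (C₁ , len₁ , clq₁ , lo) →
    clique (weaken (m≤m+n κ _) (bl 2 (from-yes (3 ≤? 3)))) λ (C₂ , len₂ , clq₂ , hi) →
    Assign.assign cvN C₁ C₂ len₁ len₂ clq₁ clq₂
      (All.map (λ (a , _ , u) → a , u) lo) (All.map (λ (a , u , _) → a , u) hi)
      Os cvs rl {m + (m + z t)} {Block A (p 1) (p 2)} (λ w → w)
      (subst (λ x → Large (pw' x (m + (m + z t))) (Block A (p 1) (p 2))) (sym lenO)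
        (weaken (m≤n+m _ κ) (bl 1 (from-yes (2 ≤? 3)))))
    λ (W , s , lW , gds) →
    -- The older fans outnumber `g t` times the candidates, so one `y` serves `g t` of them.
    let (y , y∈ , Os₁ , sub , le , good) = pigeonhole (Good N W) (g t) (C₁ ++ C₂) Os gds
          (subst (length (C₁ ++ C₂) * g t <_) (sym lenO)
            (s≤s (≤-reflexive (cong (_* g t) (trans (length-++ C₁) (cong₂ _+_ len₁ len₂))))))
        Ay = All.lookup (Allₚ.++⁺ (All.map proj₁ lo) (All.map proj₁ hi)) y∈
        Os₂ = take (g t) Os₁
        tk : ∀ {P : Fan → Set} → All P Os → All P Os₂
        tk ps = Allₚ.take⁺ (g t) (All-resp-⊆ sub ps)
    in Covers.cov cvN Ay λ (x , qx , xy) →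
      tuple-small t (x ∷ X) (traces x Os₂) (trans (sym (+-suc (length X) t)) lenX) (cpN x qx ∷ clqX)
        (trans (trim-length (traces-trim x Os₂)) (trans (length-take (g t) Os₁) (m≤n⇒m⊓n≡m le)))
        (trim-pairs (traces-trim x Os₂) (AllPairsₚ.take⁺ (g t) (AllPairs-resp-⊆ sub rls)))
        (traces-all (All.zipWith (λ {O} (cv , gd) → trace-covers {A} {W} {N} {O} cvN cv (λ w → proj₁ (s w)) Ay qx xy gd)
          (tk cvs , Allₚ.take⁺ (g t) good)))
        (traces-all (All.map (λ cp x' (q , qx) → qx ∷ cp x' q) (tk cps)))
        (drop m (Adj x) (nb x) (drop m (Adj y) (nb y) lW))
    where
    lenO : length Os ≡ suc (q₂ * g t)
    lenO = suc-injective lenE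

  all-small : ∀ {A} → ¬ Large Z A
  all-small l = build (g (suc r)) (z (suc r)) l λ (A' , l' , Es , len , ap , cvs) →
    tuple-small (suc r) [] Es refl [] len ap cvs (All.map (λ _ _ _ → []) cvs) l'

-- The induction

-- Only edges inside `A` are kept, so adjacency itself certifies membership in `A`.
module Restrict (G : XGraph) (A : XGraph.V G → Set) (A? : ∀ v → Dec (A v)) where
  open XGraph G
  open Graph G

  G' : XGraph
  G' = record
    { V = V ; pos = pos ; pos-inj = pos-inj ; top = top ; pos<top = pos<top ; unif = unif
    ; Adj   = λ u v → A u × A v × Adj u v
    ; adj?  = λ u v → A? u ×-dec (A? v ×-dec adj? u v)
    ; symm  = λ (a , b , e) → b , a , symm e
    ; irr   = λ (_ , _ , e) → irr e
    ; xfree = λ (u , v , uv) (t , a , ta) ut ua vt va →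
        xfree uv ta (λ e → ut (u , t , e)) (λ e → ua (u , a , e)) (λ e → vt (v , t , e)) (λ e → va (v , a , e)) }

  Adj' = XGraph.Adj G'
  Large' = Graph.Large G'

  from-large' : ∀ {n S} → Large' n S → Large n S
  from-large' l (f , b , p) = l (f , b , λ u v s t (_ , _ , e) → p u v s t e)

  to-large' : ∀ {n S} → S ⊆ A → Large n S → Large' n S
  to-large' s l (f , b , p) = l (f , b , λ u v x y e → p u v x y (s x , s y , e))

common : ∀ {X B : Set} {D : X → Set} {n} xs → length xs ≡ suc n → All (λ x → B × D x) xs → B
common (_ ∷ _) _ ((b , _) ∷ _) = b

unav-base : ∀ m → Unav 1 m
unav-base m = (λ c → ControlBounds.f₀ m c + ControlBounds.f₀ m c) , λ G nb c A → Control.two-control G m nb c A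

-- Without an (r+1)-configuration `NoFan` holds: `C₀` allows for removing the neighbourhoods of the
-- clique and fixing sides. Then `all-small` contradicts largeness.
unav-step : ∀ r' m → Unav (suc r') m → Unav (suc (suc r')) m
unav-step r' m (φ , un) = bnd , proof
  where
  r = suc r'
  C₀ : ℕ → ℕ
  C₀ c = suc r * m + quads (suc r) c
  bnd : ℕ → ℕ
  bnd c = Bounds.Z m r' (C₀ c) φ
  proof : (G : XGraph) → Graph.Sparse G m → Graph.Unavoidable G (suc r) bnd
  proof G nb c A l k = decide-set A λ A? → restricted A?
    where
    open XGraph G
    open Graph G
    restricted : ¬ (∀ v → Dec (A v))
    restricted A? = Step.all-small G' m r' (C₀ c) φ nb' (un G' nb') no-fan {A} (to-large' (λ a → a) l)
      where
      open Restrict G A A?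
      module H = Graph G'
      nb' : H.Sparse m
      nb' v l' = nb v (grow (λ (_ , _ , e) → e) (from-large' l'))
      no-fan : H.NoFan (suc r) (C₀ c)
      no-fan C Q W len clq QC cov l₁ =
        H.inhabited l₁ λ (_ , w) → cov w λ (_ , q₀ , _) →
        H.one-sides c {λ w → W w × All (λ h → ¬ Adj' h w) C} C
          (subst (λ n → Large' (quads n c) (λ w → W w × All (λ h → ¬ Adj' h w) C)) (sym len)
            (H.drop-all (λ h → Adj' h) C (All.tabulate (λ {h} _ → nb' h))
              (subst (λ n → Large' (n * m + quads (suc r) c) W) (sym len) l₁)))
        λ (W' , s , l₂ , os) →
        let W⊆A : ∀ {w} → W' w → A w
            W⊆A {w} x = decidable-stable (A? w) λ n → cov (proj₁ (s x)) λ (_ , _ , _ , a , _) → n a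
            C⊆A : All A C
            C⊆A = All.map (λ (_ , a , _) → a) (QC q₀)
        in k (record
          { K = C ; len = len ; clq = AllPairs.map (λ (_ , _ , e) → e) clq ; K⊆A = C⊆A ; Q = Q ; W = W'
          ; Q⊆A = λ q → common C len (QC q) ; W⊆A = W⊆A
          ; QK = λ q → All.map (λ (_ , _ , e) → e) (QC q)
          ; cov = λ x k' → cov (proj₁ (s x)) λ (y , q , _ , _ , e) → k' (y , q , e)
          ; anti = λ x → All.zipWith (λ (a , n) e → n (a , W⊆A x , e)) (C⊆A , proj₂ (s x))
          ; sides = os ; large = from-large' l₂ })

unav : ∀ r m → Unav (suc r) m
unav zero    m = unav-base m
unav (suc r) m = unav-step r m (unav r m)

-- The bound for smaller cliques applies to neighbourhoods and gives sparsity; the resulting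
-- configuration and a vertex of its `Q` form a forbidden clique.
clique-bound : ∀ k → Σ ℕ λ f → (G : XGraph) → ∀ A → Graph.CliqueFree G k A → ¬ Graph.Large G f A
clique-bound zero = 0 , λ G A none l → Graph.inhabited G l λ (v , a) → none (v ∷ []) refl ([] ∷ []) (a ∷ [])
clique-bound (suc k) with clique-bound k
... | m , ih = proj₁ (unav k m) 0 , λ G A none l → Graph.decide-set G A λ A? → restricted G A none l A?
  where
  module _ (G : XGraph) (A : XGraph.V G → Set) (none : Graph.CliqueFree G (suc k) A)
    (l : Graph.Large G (proj₁ (unav k m) 0) A) where
    restricted : ¬ (∀ v → Dec (A v))
    restricted A? = proj₂ (unav k m) G'
        (λ v → ih G' (Adj' v) λ K len clq a → none (v ∷ K) (cong suc len)
          (All.map (λ (_ , _ , e) → e) a ∷ AllPairs.map (λ (_ , _ , e) → e) clq)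
          (common K len a ∷ All.map (λ (_ , b , _) → b) a))
        0 A (to-large' (λ a → a) l) too-big
      where
      open Restrict G A A?
      too-big : ¬ Graph.Conf G' (suc k) 0 A
      too-big cf = Graph.inhabited G' large λ (w , ww) → cov ww λ (x , q , _) →
          none (x ∷ K) (cong suc len)
            (All.map (λ (_ , _ , e) → e) (QK q) ∷ AllPairs.map (λ (_ , _ , e) → e) clq) (Q⊆A q ∷ K⊆A)
        where
        open Graph.Conf cf

-- X-free ordered graphs

count : ∀ {V : Set} {P : V → Set} → (∀ v → Dec (P v)) → List V → ℕ
count P? [] = 0
count P? (x ∷ xs) with P? x
... | yes _ = suc (count P? xs)
... | no  _ = count P? xs

count-≤ : ∀ {V : Set} {P : V → Set} (P? : ∀ v → Dec (P v)) xs → count P? xs ≤ length xs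
count-≤ P? [] = z≤n
count-≤ P? (x ∷ xs) with P? x
... | yes _ = s≤s (count-≤ P? xs)
... | no  _ = m≤n⇒m≤1+n (count-≤ P? xs)

count-mono : ∀ {V : Set} {P Q : V → Set} (P? : ∀ v → Dec (P v)) (Q? : ∀ v → Dec (Q v)) → (∀ {v} → P v → Q v) →
             ∀ xs → count P? xs ≤ count Q? xs
count-mono P? Q? s [] = z≤n
count-mono P? Q? s (x ∷ xs) with P? x | Q? x
... | yes p | yes q = s≤s (count-mono P? Q? s xs)
... | yes p | no ¬q = ⊥-elim (¬q (s p))
... | no ¬p | yes q = m≤n⇒m≤1+n (count-mono P? Q? s xs)
... | no ¬p | no ¬q = count-mono P? Q? s xs

count-strict : ∀ {V : Set} {P Q : V → Set} (P? : ∀ v → Dec (P v)) (Q? : ∀ v → Dec (Q v)) → (∀ {v} → P v → Q v) →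
               ∀ {xs y} → y ∈ xs → ¬ P y → Q y → count P? xs < count Q? xs
count-strict P? Q? s {x ∷ xs} (here refl) ¬p q with P? x | Q? x
... | yes p | _     = ⊥-elim (¬p p)
... | no _  | yes _ = s≤s (count-mono P? Q? s xs)
... | no _  | no ¬q = ⊥-elim (¬q q)
count-strict P? Q? s {x ∷ xs} (there y∈) ¬p q with P? x | Q? x
... | yes p | yes q' = s≤s (count-strict P? Q? s y∈ ¬p q)
... | yes p | no ¬q  = ⊥-elim (¬q (s p))
... | no _  | yes _  = m≤n⇒m≤1+n (count-strict P? Q? s y∈ ¬p q)
... | no _  | no _   = count-strict P? Q? s y∈ ¬p q

module Ordered (G : OrderedGraph) (xf : XFree G) where
  open OrderedGraph G
  open IsStrictTotalOrder isStrictTotalOrder using (compare) renaming (irrefl to ≺-irrefl; trans to ≺-trans; _<?_ to _≺?_)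
  open Inverse finite using (to; from; strictlyInverseʳ)

  vertices : List V
  vertices = tabulate from

  ∈-vertices : ∀ v → v ∈ vertices
  ∈-vertices v = subst (_∈ vertices) (strictlyInverseʳ v) (∈-tabulate⁺ (to v))

  pos : V → ℕ
  pos v = count (_≺? v) vertices

  ≺⇒< : ∀ {u v} → u ≺ v → pos u < pos v
  ≺⇒< {u} {v} u≺v = count-strict (_≺? u) (_≺? v) (λ x → ≺-trans x u≺v) (∈-vertices u) (≺-irrefl refl) u≺v

  <⇒≺ : ∀ {u v} → pos u < pos v → u ≺ v
  <⇒≺ {u} {v} lt with compare u v
  ... | tri< u≺v _ _ = u≺v
  ... | tri≈ _ refl _ = ⊥-elim (<-irrefl refl lt)
  ... | tri> _ _ v≺u = ⊥-elim (<-asym lt (≺⇒< v≺u))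

  pos-inj : ∀ {u v} → pos u ≡ pos v → u ≡ v
  pos-inj {u} {v} e with compare u v
  ... | tri< u≺v _ _ = ⊥-elim (<⇒≢ (≺⇒< u≺v) e)
  ... | tri≈ _ e' _  = e'
  ... | tri> _ _ v≺u = ⊥-elim (<⇒≢ (≺⇒< v≺u) (sym e))

  unif : (P : ℕ → V → Set) → (∀ {i j v} → i ≤ j → P i v → P j v) →
         (∀ v → ¬ ¬ (∃ λ i → P i v)) → ¬ ¬ (∃ λ i → ∀ v → P i v)
  unif P mono h k = go vertices λ (i , ps) → k (i , λ v → All.lookup ps (∈-vertices v))
    where
    go : ∀ xs → ¬ ¬ (∃ λ i → All (P i) xs)
    go [] k = k (0 , [])
    go (x ∷ xs) k = h x λ (i , p) → go xs λ (j , ps) →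
      k (i + j , mono (m≤m+n i j) p ∷ All.map (mono (m≤n+m j i)) ps)

  lt : V → V → Bool
  lt u v = does (pos u <? pos v)

  Sep : V → V → V → V → Bool
  Sep u v t a = (lt u t xor lt u a) xor (lt v t xor lt v a)

  lt-true : ∀ {u v} → pos u < pos v → lt u v ≡ true
  lt-true {u} {v} = dec-true (pos u <? pos v)

  lt-false : ∀ {u v} → pos v ≤ pos u → lt u v ≡ false
  lt-false {u} {v} p = dec-false (pos u <? pos v) (≤⇒≯ p)

  sep-swapˡ : ∀ u v t a → Sep u v t a ≡ Sep v u t a
  sep-swapˡ u v t a = xor-comm (lt u t xor lt u a) (lt v t xor lt v a)

  sep-swapʳ : ∀ u v t a → Sep u v t a ≡ Sep u v a t
  sep-swapʳ u v t a = cong₂ _xor_ (xor-comm (lt u t) (lt u a)) (xor-comm (lt v t) (lt v a))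

  sep-cong : ∀ {u v t a b₁ b₂ b₃ b₄} → lt u t ≡ b₁ → lt u a ≡ b₂ → lt v t ≡ b₃ → lt v a ≡ b₄ →
             Sep u v t a ≡ (b₁ xor b₂) xor (b₃ xor b₄)
  sep-cong refl refl refl refl = refl

  module _ {u v t a : V} (uv : Adj u v) (ta : Adj t a) (ut : ¬ Adj u t) (ua : ¬ Adj u a) (vt : ¬ Adj v t) (va : ¬ Adj v a) where
    -- Nested and disjoint chords have parity `false`; the two alternating orders are induced copies
    -- of `X`.
    sorted : pos u < pos v → pos t < pos a → Sep u v t a ≡ false
    sorted u<v t<a with pos u <? pos a
    ... | no u≮a = sep-cong (lt-false (<⇒≤ (<-≤-trans t<a a≤u))) (lt-false a≤u)
                            (lt-false (<⇒≤ (<-trans (<-≤-trans t<a a≤u) u<v))) (lt-false (<⇒≤ (≤-<-trans a≤u u<v)))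
      where a≤u = ≮⇒≥ u≮a
    ... | yes u<a with <-cmp (pos v) (pos t)
    ...   | tri< v<t _ _ = sep-cong (lt-true (<-trans u<v v<t)) (lt-true u<a) (lt-true v<t) (lt-true (<-trans v<t t<a))
    ...   | tri≈ _ e _ = ⊥-elim (va (subst (λ x → Adj x a) (sym (pos-inj e)) ta))
    ...   | tri> _ _ t<v with <-cmp (pos u) (pos t) | <-cmp (pos v) (pos a)
    ...     | tri≈ _ e _ | _ = ⊥-elim (ua (subst (λ x → Adj x a) (sym (pos-inj e)) ta))
    ...     | _ | tri≈ _ e _ = ⊥-elim (vt (symm (subst (Adj t) (sym (pos-inj e)) ta)))
    ...     | tri< u<t _ _ | tri> _ _ a<v =
      sep-cong (lt-true u<t) (lt-true u<a) (lt-false (<⇒≤ t<v)) (lt-false (<⇒≤ a<v))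
    ...     | tri> _ _ t<u | tri< v<a _ _ =
      sep-cong (lt-false (<⇒≤ t<u)) (lt-true u<a) (lt-false (<⇒≤ t<v)) (lt-true v<a)
    ...     | tri< u<t _ _ | tri< v<a _ _ = ⊥-elim (xf u t v a record
      { a≺b = <⇒≺ u<t ; b≺c = <⇒≺ t<v ; c≺d = <⇒≺ v<a ; ac = uv ; bd = ta
      ; ¬ab = ut ; ¬bc = λ e → vt (symm e) ; ¬cd = va ; ¬ad = ua })
    ...     | tri> _ _ t<u | tri> _ _ a<v = ⊥-elim (xf t u a v record
      { a≺b = <⇒≺ t<u ; b≺c = <⇒≺ u<a ; c≺d = <⇒≺ a<v ; ac = ta ; bd = uv
      ; ¬ab = λ e → ut (symm e) ; ¬bc = ua ; ¬cd = λ e → va (symm e) ; ¬ad = λ e → vt (symm e) })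

  xfree : ∀ {u v t a} → Adj u v → Adj t a → ¬ Adj u t → ¬ Adj u a → ¬ Adj v t → ¬ Adj v a → Sep u v t a ≡ false
  xfree {u} {v} {t} {a} uv ta ut ua vt va with <-cmp (pos u) (pos v) | <-cmp (pos t) (pos a)
  ... | tri≈ _ e _ | _ = ⊥-elim (irrefl (pos-inj e) uv)
  ... | _ | tri≈ _ e _ = ⊥-elim (irrefl (pos-inj e) ta)
  ... | tri< u<v _ _ | tri< t<a _ _ = sorted uv ta ut ua vt va u<v t<a
  ... | tri> _ _ v<u | tri< t<a _ _ = trans (sep-swapˡ u v t a) (sorted (symm uv) ta vt va ut ua v<u t<a)
  ... | tri< u<v _ _ | tri> _ _ a<t = trans (sep-swapʳ u v t a) (sorted uv (symm ta) ua ut va vt u<v a<t)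
  ... | tri> _ _ v<u | tri> _ _ a<t =
    trans (sep-swapˡ u v t a) (trans (sep-swapʳ v u t a) (sorted (symm uv) (symm ta) va vt ua ut v<u a<t))

  xgraph : XGraph
  xgraph = record
    { V = V ; pos = pos ; pos-inj = pos-inj ; top = suc (length vertices)
    ; pos<top = λ v → s≤s (count-≤ (_≺? v) vertices) ; unif = unif
    ; Adj = Adj ; adj? = adj? ; symm = symm ; irr = irrefl refl ; xfree = xfree }

  open Graph xgraph using (Col)

  colourable : ∀ {n} → Col n (λ _ → ⊤) → Colourable graph n
  colourable (f , bound , proper) = (λ v → fromℕ< (bound v tt)) ,
    λ u v uv e → proper u v tt tt uv (fromℕ<-injective _ _ _ _ e)

  clique-of : ∀ K → AllPairs Adj K → HasClique graph (length K)
  clique-of K clq = lookup K , pairs K clq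
    where
    pairs : ∀ K → AllPairs Adj K → ∀ i j → i ≢ j → Adj (lookup K i) (lookup K j)
    pairs (x ∷ K) (a ∷ clq) fzero    fzero    i≢j = ⊥-elim (i≢j refl)
    pairs (x ∷ K) (a ∷ clq) fzero    (fsuc j) i≢j = All.lookup a (∈-lookup j)
    pairs (x ∷ K) (a ∷ clq) (fsuc i) fzero    i≢j = symm (All.lookup a (∈-lookup i))
    pairs (x ∷ K) (a ∷ clq) (fsuc i) (fsuc j) i≢j = pairs K clq i j λ { refl → i≢j refl }

theorem1p7 : ∃ λ (f : ℕ → ℕ) → (G : OrderedGraph) → XFree G → χ (OrderedGraph.graph G) ≤ f (ω (OrderedGraph.graph G))
theorem1p7 = (λ k → proj₁ (clique-bound k)) , bounded
  where
  bounded : (G : OrderedGraph) → XFree G → χ (OrderedGraph.graph G) ≤ proj₁ (clique-bound (ω (OrderedGraph.graph G)))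
  -- The inequality is decidable, so the double negation is removed here.
  bounded G xf = decidable-stable (χ graph ≤? proj₁ (clique-bound (ω graph))) λ χ≰f →
      proj₂ (clique-bound (ω graph)) xgraph (λ _ → ⊤)
        (λ K len clq _ → 1+n≰n (proj₂ (proj₂ (cliqueNumber graph)) (suc (ω graph))
          (subst (HasClique graph) len (clique-of K clq))))
        λ col → χ≰f (proj₂ (proj₂ (chromaticNumber graph)) _ (colourable col))
    where
    open OrderedGraph G using (graph)
    open Ordered G xf
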